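{- For the Server Cloud Scheduling problem restricted to fully parallel task graphs there is an FPTAS with respect to the cost objective (minimize cost subject to makespan at most a given deadline $d$) and an FPTAS with respect to the makespan objective (minimize makespan subject to cost at most a given budget $b$).
   Context: Server Cloud Scheduling: the input is a directed acyclic task graph $G=(\mathcal{J},E)$ with exactly one source $s$ and one sink $t$; each job $j\in\mathcal{J}$ has a server processing time $p_s(j)\in\mathbb{N}_0$ and a cloud processing time $p_c(j)\in\mathbb{N}_0$, where $p_s(s)=p_s(t)=0$ and $p_c(s)=p_c(t)=\infty$; each edge $(i,j)\in E$ has a communication delay $c(i,j)\in\mathbb{N}_0$. There is one server machine (processing at most one job at a time) and unboundedly many cloud machines. A schedule is a partition $\mathcal{J}=\mathcal{J}_s\cup\mathcal{J}_c$ together with completion times $C:\mathcal{J}\to\mathbb{N}_0$; let $p_\pi(j)=p_s(j)$ if $j\in\mathcal{J}_s$ and $p_\pi(j)=p_c(j)$ if $j\in\mathcal{J}_c$. It is valid if (a) for distinct $i,j\in\mathcal{J}_s$: $C(i)\le C(j)-p_\pi(j)$ or $C(i)-p_\pi(i)\ge C(j)$; (b) for every edge $(i,j)$ with $i,j$ on the same side: $C(i)\le C(j)-p_\pi(j)$, and for every edge with $i,j$ on different sides: $C(i)+c(i,j)\le C(j)-p_\pi(j)$. The makespan is $C(t)$ and the cost is $\sum_{j\in\mathcal{J}_c}p_c(j)$. A task graph is fully parallel if every job $j\notin\{s,t\}$ has exactly two incident edges, namely $(s,j)$ and $(j,t)$. -}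

module Defs where

open import Data.Fin.Base using (Fin; toℕ)
open import Data.Integer.Base as ℤ using ()
open import Data.List.Base using (List; []; _∷_; tabulate)
open import Data.Maybe using (Is-just; maybe′; zipWith)
open import Data.Nat.Base
open import Data.Nat.Logarithm using (⌊log₂_⌋)
open import Data.Product.Base using (Σ; ∃; ∃₂; _×_; _,_; proj₁; proj₂)
open import Data.Rational.Base as ℚ using (ℚ; ceiling; 1ℚ; 1/_)
open import Data.Rational.Properties using (pos⇒nonZero)
open import Data.Sum.Base using (_⊎_; inj₁; inj₂)
open import Data.Unit.Base using (⊤; tt)
open import Data.Vec.Functional using (foldr)
open import Function.Base using (_∘_)
open import Function.Bundles using (_⇔_)
open import Relation.Binary.Construct.Closure.Transitive using (TransClosure)
open import Relation.Binary.PropositionalEquality.Core using (_≡_; _≢_)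
open import Relation.Nullary.Construct.Add.Supremum using (_⁺; ⊤⁺; [_])
open import Relation.Nullary.Decidable.Core using (yes; no)
open import Relation.Nullary.Negation.Core using (¬_)

import Relation.Binary.Construct.Add.Supremum.NonStrict as AddSupremum

------------------------------------------------------------------------
-- A model of computation
--
-- A first-order language with unbounded loops, under the logarithmic
-- cost criterion: an elementary step costs the bit sizes of its argument
-- and of its result.  A run is charged at least the size of every value
-- it produces, and each elementary step is polynomial-time computable in
-- those sizes, so running times agree with those of Turing machines up
-- to a polynomial.

infixr 6 _⊗_
infixr 5 _⊕_

data Ty : Set where
  nat unit : Ty
  _⊗_ _⊕_  : Ty → Ty → Ty
  list     : Ty → Ty

⟦_⟧ : Ty → Set
⟦ nat ⟧    = ℕ
⟦ unit ⟧   = ⊤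
⟦ A ⊗ B ⟧  = ⟦ A ⟧ × ⟦ B ⟧
⟦ A ⊕ B ⟧  = ⟦ A ⟧ ⊎ ⟦ B ⟧
⟦ list A ⟧ = List ⟦ A ⟧

-- Naturals are written in binary.
size : ∀ A → ⟦ A ⟧ → ℕ
size nat      n        = suc ⌊log₂ n ⌋
size unit     _        = 1
size (A ⊗ B)  (x , y)  = suc (size A x + size B y)
size (A ⊕ B)  (inj₁ x) = suc (size A x)
size (A ⊕ B)  (inj₂ y) = suc (size B y)
size (list A) []       = 1
size (list A) (x ∷ xs) = suc (size A x + size (list A) xs)

private variable
  A B C D : Ty

data Op : Ty → Ty → Set where
  id      : Op A A
  fst     : Op (A ⊗ B) A
  snd     : Op (A ⊗ B) B
  inl     : Op A (A ⊕ B)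
  inr     : Op B (A ⊕ B)
  drop    : Op A unit
  nil     : Op A (list B)
  cons    : Op (A ⊗ list A) (list A)
  uncons  : Op (list A) (unit ⊕ (A ⊗ list A))
  lit     : ℕ → Op A nat
  add sub mul div : Op (nat ⊗ nat) nat
  leq     : Op (nat ⊗ nat) (unit ⊕ unit)

apply : Op A B → ⟦ A ⟧ → ⟦ B ⟧
apply id      x            = x
apply fst     (x , _)      = x
apply snd     (_ , y)      = y
apply inl     x            = inj₁ x
apply inr     y            = inj₂ y
apply drop    _            = tt
apply nil     _            = []
apply cons    (x , xs)     = x ∷ xs
apply uncons  []           = inj₁ tt
apply uncons  (x ∷ xs)     = inj₂ (x , xs)
apply (lit n) _            = n
apply add     (m , n)      = m + n
apply sub     (m , n)      = m ∸ n
apply mul     (m , n)      = m * n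
apply div     (m , zero)   = 0
apply div     (m , suc n)  = m / suc n
apply leq     (m , n)      with m ≤? n
  where open import Data.Nat.Properties using (_≤?_)
... | yes _ = inj₁ tt
... | no  _ = inj₂ tt

infixr 4 _⨾_

data Program : Ty → Ty → Set where
  op    : Op A B → Program A B
  _⨾_   : Program A B → Program B C → Program A C
  pair  : Program A B → Program A C → Program A (B ⊗ C)
  match : Program (A ⊗ C) D → Program (B ⊗ C) D → Program ((A ⊕ B) ⊗ C) D
  loop  : Program A (A ⊕ B) → Program A B

infix 3 _∙_⇓_cost_

-- p ∙ x ⇓ y cost n : started on x, the program p halts with result y
-- after time n.  A loop runs its body until the body returns inj₂.
data _∙_⇓_cost_ : Program A B → ⟦ A ⟧ → ⟦ B ⟧ → ℕ → Set where
  op : ∀ {A B} (o : Op A B) (x : ⟦ A ⟧) →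
       op o ∙ x ⇓ apply o x cost size A x + size B (apply o x)

  _⨾_ : ∀ {p : Program A B} {q : Program B C} {x y z m n} →
        p ∙ x ⇓ y cost m → q ∙ y ⇓ z cost n →
        p ⨾ q ∙ x ⇓ z cost suc (m + n)

  pair : ∀ {p : Program A B} {q : Program A C} {x y z m n} →
         p ∙ x ⇓ y cost m → q ∙ x ⇓ z cost n →
         pair p q ∙ x ⇓ (y , z) cost suc (m + n)

  match₁ : ∀ {p : Program (A ⊗ C) D} {q : Program (B ⊗ C) D} {x w y n} →
           p ∙ (x , w) ⇓ y cost n →
           match p q ∙ (inj₁ x , w) ⇓ y cost suc n

  match₂ : ∀ {p : Program (A ⊗ C) D} {q : Program (B ⊗ C) D} {x w y n} →
           q ∙ (x , w) ⇓ y cost n →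
           match p q ∙ (inj₂ x , w) ⇓ y cost suc n

  stop : ∀ {p : Program A (A ⊕ B)} {x y n} →
         p ∙ x ⇓ inj₂ y cost n →
         loop p ∙ x ⇓ y cost suc n

  continue : ∀ {p : Program A (A ⊕ B)} {x x′ y m n} →
             p ∙ x ⇓ inj₁ x′ cost m → loop p ∙ x′ ⇓ y cost n →
             loop p ∙ x ⇓ y cost suc (m + n)

------------------------------------------------------------------------
-- Minimisation problems and FPTASs

record MinProblem : Set₁ where
  field
    Instance     : Set
    Solution     : Instance → Set
    -- HasValue I S v : S is a feasible solution of I of objective value v
    HasValue     : (I : Instance) → Solution I → ℕ → Set
    input output : Ty
    encode       : Instance → ⟦ input ⟧
    encodeSol    : ∀ I → Solution I → ⟦ output ⟧

fromℕ : ℕ → ℚ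
fromℕ n = (ℤ.+ n) ℚ./ 1

⌈1/_⌉ : (ε : ℚ) .{{_ : ℚ.Positive ε}} → ℕ
⌈1/ ε ⌉ = ℤ.∣ ceiling ((1/ ε) {{pos⇒nonZero ε}}) ∣

module _ (P : MinProblem) where
  open MinProblem P

  -- inj₁ reports that the instance is infeasible.
  data Approximates (I : Instance) (ε : ℚ) : ⟦ unit ⊕ output ⟧ → Set where
    infeasible : (∀ S v → ¬ HasValue I S v) → Approximates I ε (inj₁ tt)

    solution : ∀ S v → HasValue I S v →
               (∀ T w → HasValue I T w →
                  fromℕ v ℚ.≤ (1ℚ ℚ.+ ε) ℚ.* fromℕ w) →
               Approximates I ε (inj₂ (encodeSol I S))

  -- One program serves all accuracies.  It is given ⌈1/ε⌉ rather than a
  -- numerator and denominator of ε: their length is not bounded in terms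
  -- of 1/ε, so merely reading them could exceed the time allowed.
  record FPTAS : Set where
    field
      program     : Program (nat ⊗ input) (unit ⊕ output)
      coefficient : ℕ
      degree      : ℕ
      correct     : ∀ (I : Instance) (ε : ℚ) .{{_ : ℚ.Positive ε}} →
        ∃₂ λ y time →
          (program ∙ (⌈1/ ε ⌉ , encode I) ⇓ y cost time) ×
          time ≤ coefficient * (size input (encode I) + ⌈1/ ε ⌉) ^ degree ×
          Approximates I ε y

------------------------------------------------------------------------
-- Server Cloud Scheduling

ℕ∞ : Set
ℕ∞ = ℕ ⁺

open AddSupremum _≤_ public using () renaming (_≤⁺_ to _≤∞_)

infixl 6 _+∞_

_+∞_ : ℕ∞ → ℕ∞ → ℕ∞
_+∞_ = zipWith _+_

record TaskGraph : Set where
  field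
    jobs        : ℕ
    source sink : Fin jobs
    serverTime  : Fin jobs → ℕ
    cloudTime   : Fin jobs → ℕ∞
    -- just c on the edges, with c the communication delay;
    -- nothing on the non-edges
    delay       : Fin jobs → Fin jobs → ℕ ⁺

  Job : Set
  Job = Fin jobs

  Edge : Job → Job → Set
  Edge i j = Is-just (delay i j)

  field
    acyclic           : ∀ j → ¬ TransClosure Edge j j
    source-unique     : ∀ j → (∀ i → ¬ Edge i j) ⇔ j ≡ source
    sink-unique       : ∀ j → (∀ i → ¬ Edge j i) ⇔ j ≡ sink
    serverTime-source : serverTime source ≡ 0
    serverTime-sink   : serverTime sink ≡ 0
    cloudTime-∞       : ∀ j → cloudTime j ≡ ⊤⁺ ⇔ (j ≡ source ⊎ j ≡ sink)

FullyParallel : TaskGraph → Set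
FullyParallel G = ∀ j → j ≢ source → j ≢ sink →
  ∀ u v → (Edge u v × (u ≡ j ⊎ v ≡ j)) ⇔
          ((u ≡ source × v ≡ j) ⊎ (u ≡ j × v ≡ sink))
  where open TaskGraph G

data Side : Set where
  server cloud : Side

module _ (G : TaskGraph) where
  open TaskGraph G

  record Schedule : Set where
    field
      side       : Job → Side
      completion : Job → ℕ

module _ {G : TaskGraph} (σ : Schedule G) where
  open TaskGraph G
  open Schedule σ

  procTime : Job → ℕ∞
  procTime j with side j
  ... | server = [ serverTime j ]
  ... | cloud  = cloudTime j

  -- x ≤ C(j) − p(j)
  _≤start_ : ℕ → Job → Set
  x ≤start j = [ x ] +∞ procTime j ≤∞ [ completion j ]

  record Valid : Set where
    field
      machine    : ∀ i j → i ≢ j → side i ≡ server → side j ≡ server →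
                   completion i ≤start j ⊎ completion j ≤start i
      precedence : ∀ i j → Edge i j → side i ≡ side j →
                   completion i ≤start j
      transfer   : ∀ i j c → delay i j ≡ [ c ] → side i ≢ side j →
                   (completion i + c) ≤start j

  makespan : ℕ
  makespan = completion sink

  cloudCost : Job → ℕ∞
  cloudCost j with side j
  ... | server = [ 0 ]
  ... | cloud  = cloudTime j

  totalCost : ℕ∞
  totalCost = foldr _+∞_ [ 0 ] cloudCost

extended graph schedule : Ty
extended = unit ⊕ nat
graph    = nat ⊗ nat ⊗ list nat ⊗ list extended ⊗ list (list extended)
schedule = list ((unit ⊕ unit) ⊗ nat)

encodeExtended : ℕ ⁺ → ⟦ extended ⟧
encodeExtended = maybe′ inj₂ (inj₁ tt)

encodeGraph : TaskGraph → ⟦ graph ⟧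
encodeGraph G = toℕ source , toℕ sink , tabulate serverTime ,
                tabulate (encodeExtended ∘ cloudTime) ,
                tabulate (λ i → tabulate (encodeExtended ∘ delay i))
  where open TaskGraph G

encodeSide : Side → ⟦ unit ⊕ unit ⟧
encodeSide server = inj₁ tt
encodeSide cloud  = inj₂ tt

encodeSchedule : ∀ {G} → Schedule G → ⟦ schedule ⟧
encodeSchedule σ = tabulate (λ j → encodeSide (side j) , completion j)
  where open Schedule σ

-- A fully parallel task graph with a deadline, respectively a budget.
BoundedInstance : Set
BoundedInstance = Σ TaskGraph FullyParallel × ℕ

encodeInstance : BoundedInstance → ⟦ graph ⊗ nat ⟧
encodeInstance ((G , _) , bound) = encodeGraph G , bound

-- A schedule of cost ∞ has no objective value in ℕ and so is not a
-- solution: source and sink stay on the server.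
MinCost : MinProblem
MinCost = record
  { Instance  = BoundedInstance
  ; Solution  = λ I → Schedule (proj₁ (proj₁ I))
  ; HasValue  = λ (_ , d) σ v → Valid σ × makespan σ ≤ d × totalCost σ ≡ [ v ]
  ; input     = graph ⊗ nat
  ; output    = schedule
  ; encode    = encodeInstance
  ; encodeSol = λ _ → encodeSchedule
  }

MinMakespan : MinProblem
MinMakespan = record
  { Instance  = BoundedInstance
  ; Solution  = λ I → Schedule (proj₁ (proj₁ I))
  ; HasValue  = λ (_ , b) σ v → Valid σ × totalCost σ ≤∞ [ b ] × makespan σ ≡ v
  ; input     = graph ⊗ nat
  ; output    = schedule
  ; encode    = encodeInstance
  ; encodeSol = λ _ → encodeSchedule
  }

{-# OPTIONS --safe #-}

-- With source and sink on the server, a set of offloaded jobs fits into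
-- makespan M exactly if every offloaded job can be back by M and the
-- remaining jobs have total server time at most M.  For a fixed threshold
-- on the return times both problems are therefore knapsack problems, one
-- with the roles of server load and cloud cost exchanged, and only the
-- makespan problem has to try several thresholds: 0 and the return times.
--
-- The knapsack problem is solved by dynamic programming over costs rounded
-- in units of g / N, for each guess g of the largest cost in an optimal
-- solution; N is polynomial in the number of jobs and in ⌈1/ε⌉.
--
-- Running times are tracked by composing polynomial-time functions: a run
-- is charged for the size of its result, so these are closed under
-- composition, and under folds whose intermediate results stay polynomial.

module Submission where

open import Data.Fin.Base as Fin using (Fin; zero; suc; toℕ)
open import Data.Fin.Properties as Finₚ using (toℕ-injective)
open import Data.Integer.Base as ℤ using ()
import Data.Integer.DivMod as ℤ
import Data.Integer.Properties as ℤ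
open import Data.List.Base
  using (List; []; _∷_; _++_; foldl; foldr; length; reverse; map; concat; concatMap; tabulate)
open import Data.List.Membership.Propositional using (_∈_; lose; find)
open import Data.List.Membership.Propositional.Properties
  using (∈-concatMap⁺; ∈-concatMap⁻; ∈-map⁺; ∈-map⁻; ∈-tabulate⁺)
open import Data.List.Properties
  using (map-is-foldr; ++-is-foldr; foldr-cong; length-map; length-++; map-tabulate; tabulate-cong;
         reverse-foldl; reverse-involutive)
open import Data.List.Relation.Binary.Pointwise
  using (Pointwise; []; _∷_; tabulate⁺) renaming (Pointwise-length to chosen-length)
open import Data.List.Relation.Unary.Any using (Any; here; there)
open import Data.Maybe using (Is-just; just; fromMaybe)
import Data.Maybe.Relation.Unary.Any as Maybe
open import Data.Nat.Base
open import Data.Nat.Coprimality as Coprimality using (1-coprimeTo)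
open import Data.Nat.DivMod using (m/n≤m; m/n*n≤m; m≡m%n+[m/n]*n; m%n<n)
open import Data.Nat.ListAction using (sum)
open import Data.Nat.Logarithm
open import Data.Nat.Properties
open import Data.Nat.Solver using (module +-*-Solver)
open import Data.Product.Base using (∃; ∃₂; _×_; _,_; proj₁; proj₂)
open import Data.Rational.Base as ℚ using (ℚ; mkℚ; 1ℚ; 1/_)
import Data.Rational.Properties as ℚ
open import Data.Sum.Base as Sum using (_⊎_; inj₁; inj₂)
open import Data.Unit.Base using (⊤; tt)
import Data.Vec.Functional as Vec
open import Function.Base using (_∘_; flip)
open import Function.Bundles using (module Equivalence)
open import Relation.Binary.Definitions using (tri<; tri≈; tri>)
open import Relation.Binary.PropositionalEquality hiding ([_])
open import Relation.Nullary using (¬_; yes; no; contradiction)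
open import Defs

import Relation.Binary.Construct.Add.Supremum.NonStrict as AddSupremum
open AddSupremum _≤_ using ([_]; [≤]-injective)

-- The rounding unit `g / N` needs a positive `g`, although the optimum may be 0. Hence 1 is always
-- among the guesses, and the guarantee takes the form K v ≤ K w + max(1, w) with K = ⌈1/ε⌉ + 1. For
-- w = 0 the summand 1 is harmless since K ≥ 2 then leaves only v = 0. With N = (n + 1) K for n
-- items, the n rounding errors together stay below g / K.
--
-- The makespan is the maximum of server load and threshold, not a sum. Only the load is
-- approximated by the knapsack table; the threshold is exact and may be taken as the largest return
-- time not beyond the optimum, so it adds no error.
--
-- A table whose length is polynomial in the value ⌈1/ε⌉ is not polynomial in the binary length of
-- that value. The accuracy is therefore first written in unary, as a list of units, and every count
-- that determines a table length is the length of a list; polynomial sizes then follow from the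
-- list combinators alone.
--
-- That the total server load is a lower bound on the makespan is proved by counting, for each unit
-- time slot, the server jobs running in it.

private variable
  A B C D S Γ : Ty

-- Polynomial bounds

infix 4 _≲_

-- The base is at least 2, so raising the exponent absorbs constants, sums and coefficients, and a
-- single number witnesses the bound.
_≲_ : {X : Set} → (X → ℕ) → (X → ℕ) → Set
f ≲ m = ∃ λ e → ∀ x → f x ≤ (2 + m x) ^ e

module _ {X : Set} {m : X → ℕ} where

  private
    power-mono : ∀ x {d e} → d ≤ e → (2 + m x) ^ d ≤ (2 + m x) ^ e
    power-mono x = ^-monoʳ-≤ (2 + m x)

  abstract
    ≲-mono : ∀ {f g} → (∀ x → f x ≤ g x) → g ≲ m → f ≲ m
    ≲-mono f≤g (e , g≤) = e , λ x → ≤-trans (f≤g x) (g≤ x)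

    ≲-measure : m ≲ m
    ≲-measure = 1 , λ x → begin
      m x            ≤⟨ m≤n+m (m x) 2 ⟩
      2 + m x        ≡⟨ *-identityʳ _ ⟨
      (2 + m x) ^ 1  ∎
      where open ≤-Reasoning

    ≲-const : ∀ c → (λ _ → c) ≲ m
    ≲-const c = c , λ x → begin
      c              ≤⟨ n≤2^n c ⟩
      2 ^ c          ≤⟨ ^-monoˡ-≤ c (m≤m+n 2 (m x)) ⟩
      (2 + m x) ^ c  ∎
      where
      open ≤-Reasoning
      n≤2^n : ∀ n → n ≤ 2 ^ n
      n≤2^n zero    = z≤n
      n≤2^n (suc n) = begin
        1 + n                ≤⟨ +-mono-≤ (m^n>0 2 n) (n≤2^n n) ⟩
        2 ^ n + 2 ^ n        ≡⟨ cong (2 ^ n +_) (+-identityʳ _) ⟨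
        2 ^ suc n            ∎

    ≲-+ : ∀ {f g} → f ≲ m → g ≲ m → (λ x → f x + g x) ≲ m
    ≲-+ {f} {g} (d , f≤) (e , g≤) = suc (d + e) , λ x → let b = 2 + m x in begin
      f x + g x                    ≤⟨ +-mono-≤ (f≤ x) (g≤ x) ⟩
      b ^ d + b ^ e                ≤⟨ +-mono-≤ (power-mono x (m≤m+n d e)) (power-mono x (m≤n+m e d)) ⟩
      b ^ (d + e) + b ^ (d + e)    ≡⟨ cong (b ^ (d + e) +_) (+-identityʳ _) ⟨
      2 * b ^ (d + e)              ≤⟨ *-monoˡ-≤ (b ^ (d + e)) (m≤m+n 2 (m x)) ⟩
      b ^ suc (d + e)              ∎
      where open ≤-Reasoning

    ≲-* : ∀ {f g} → f ≲ m → g ≲ m → (λ x → f x * g x) ≲ m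
    ≲-* {f} {g} (d , f≤) (e , g≤) = d + e , λ x → let b = 2 + m x in begin
      f x * g x        ≤⟨ *-mono-≤ (f≤ x) (g≤ x) ⟩
      b ^ d * b ^ e    ≡⟨ ^-distribˡ-+-* b d e ⟨
      b ^ (d + e)      ∎
      where open ≤-Reasoning

    ≲-suc : ∀ {f} → f ≲ m → (λ x → suc (f x)) ≲ m
    ≲-suc = ≲-+ (≲-const 1)

    ≲-^ : ∀ {f} e → f ≲ m → (λ x → f x ^ e) ≲ m
    ≲-^ {f} e (d , f≤) = d * e , λ x → begin
      f x ^ e              ≤⟨ ^-monoˡ-≤ e (f≤ x) ⟩
      ((2 + m x) ^ d) ^ e  ≡⟨ ^-*-assoc (2 + m x) d e ⟩
      (2 + m x) ^ (d * e)  ∎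
      where open ≤-Reasoning

    ≲-power : ∀ {f} e → f ≲ m → (λ x → (2 + f x) ^ e) ≲ m
    ≲-power e f≲ = ≲-^ e (≲-+ (≲-const 2) f≲)

-- Sizes

n<2^size : ∀ n → n < 2 ^ size nat n
n<2^size n with 2 ^ size nat n ≤? n
... | no  2^s≰n = ≰⇒> 2^s≰n
... | yes 2^s≤n = contradiction (begin
  suc ⌊log₂ n ⌋                ≡⟨ ⌊log₂[2^n]⌋≡n (suc ⌊log₂ n ⌋) ⟨
  ⌊log₂ (2 ^ suc ⌊log₂ n ⌋) ⌋  ≤⟨ ⌊log₂⌋-mono-≤ 2^s≤n ⟩
  ⌊log₂ n ⌋                    ∎) (<-irrefl refl)
  where open ≤-Reasoning

-- With `n<2^size` this identifies `size nat` as a bit length, so that size bounds can be proved by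
-- comparing powers of two. The induction halves `n`, which lowers the logarithm by one.
n<2^s⇒size≤s : ∀ {n s} → n < 2 ^ suc s → size nat n ≤ suc s
n<2^s⇒size≤s {n} {zero}  n<2 = s≤s (⌊log₂⌋-mono-≤ (s≤s⁻¹ n<2))
n<2^s⇒size≤s {n} {suc s} n<2^s = s≤s (begin
  -- Only an inequality, because the truncated predecessor loses nothing when the logarithm is
  -- already 0.
  ⌊log₂ n ⌋                    ≤⟨ m≤n+m∸n ⌊log₂ n ⌋ 1 ⟩
  suc (⌊log₂ n ⌋ ∸ 1)          ≡⟨ cong suc (⌊log₂⌊n/2⌋⌋≡⌊log₂n⌋∸1 n) ⟨
  size nat ⌊ n /2⌋             ≤⟨ n<2^s⇒size≤s (half-< {b = 2 ^ suc s} n<2^s) ⟩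
  suc s                        ∎)
  where
  open ≤-Reasoning
  half-< : ∀ {n b} → n < 2 * b → ⌊ n /2⌋ < b
  half-< {n} {b} n<2b = *-cancelˡ-< 2 _ _ (begin-strict
    2 * ⌊ n /2⌋              ≡⟨ cong (⌊ n /2⌋ +_) (+-identityʳ _) ⟩
    ⌊ n /2⌋ + ⌊ n /2⌋        ≤⟨ +-monoʳ-≤ ⌊ n /2⌋ (⌊n/2⌋≤⌈n/2⌉ n) ⟩
    ⌊ n /2⌋ + ⌈ n /2⌉        ≡⟨ ⌊n/2⌋+⌈n/2⌉≡n n ⟩
    n                        <⟨ n<2b ⟩
    2 * b                    ∎)

size-mono : ∀ {m n} → m ≤ n → size nat m ≤ size nat n
size-mono m≤n = s≤s (⌊log₂⌋-mono-≤ m≤n)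

size-* : ∀ m n → size nat (m * n) ≤ size nat m + size nat n
size-* m n = n<2^s⇒size≤s (begin-strict
  m * n                                  <⟨ *-mono-< (n<2^size m) (n<2^size n) ⟩
  2 ^ size nat m * 2 ^ size nat n        ≡⟨ ^-distribˡ-+-* 2 (size nat m) (size nat n) ⟨
  2 ^ (size nat m + size nat n)          ∎)
  where open ≤-Reasoning

-- Weaker than the maximum plus one, but additive: along a fold of additions such bounds telescope
-- to the size of the list that is summed.
size-+ : ∀ m n → size nat (m + n) ≤ size nat m + size nat n
size-+ m n = n<2^s⇒size≤s (begin-strict
  m + n                                  <⟨ +-mono-< (n<2^size m) (n<2^size n) ⟩
  2 * a + 2 * b                          ≤⟨ +-mono-≤ (*-monoʳ-≤ 2 (m≤m*n a b {{m^n≢0 2 ⌊log₂ n ⌋}})) (*-monoʳ-≤ 2 (m≤n*m b a {{m^n≢0 2 ⌊log₂ m ⌋}})) ⟩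
  2 * (a * b) + 2 * (a * b)              ≡⟨ solve 2 (λ a b → con 2 :* (a :* b) :+ con 2 :* (a :* b) := con 2 :* a :* (con 2 :* b)) refl a b ⟩
  2 * a * (2 * b)                        ≡⟨ ^-distribˡ-+-* 2 (size nat m) (size nat n) ⟨
  2 ^ (size nat m + size nat n)          ∎)
  where
  open ≤-Reasoning
  open +-*-Solver
  a b : ℕ
  a = 2 ^ ⌊log₂ m ⌋
  b = 2 ^ ⌊log₂ n ⌋

size≤1+n : ∀ n → size nat n ≤ suc n
size≤1+n n = n<2^s⇒size≤s (n<2^1+n n)
  where
  n<2^1+n : ∀ n → n < 2 ^ suc n
  n<2^1+n zero    = s≤s z≤n
  n<2^1+n (suc n) = begin-strict
    1 + n                    <⟨ +-mono-≤-< (m^n>0 2 (suc n)) (n<2^1+n n) ⟩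
    2 ^ suc n + 2 ^ suc n    ≡⟨ cong (2 ^ suc n +_) (+-identityʳ _) ⟨
    2 ^ suc (suc n)          ∎
    where open ≤-Reasoning

size-list-≥1 : ∀ (xs : List ⟦ A ⟧) → 1 ≤ size (list A) xs
size-list-≥1 []       = s≤s z≤n
size-list-≥1 (x ∷ xs) = s≤s z≤n

length<size : ∀ (xs : List ⟦ A ⟧) → length xs < size (list A) xs
length<size     []       = s≤s z≤n
length<size {A} (x ∷ xs) = s≤s (≤-trans (length<size {A} xs) (m≤n+m _ _))

size-++ : ∀ (xs ys : List ⟦ A ⟧) → size (list A) (xs ++ ys) < size (list A) xs + size (list A) ys
size-++     []       ys = ≤-refl
size-++ {A} (x ∷ xs) ys = s≤s (≤-trans (≤-reflexive (sym (+-suc _ _))) (≤-trans (+-monoʳ-≤ (size A x) (size-++ {A} xs ys)) (≤-reflexive (sym (+-assoc (size A x) _ _)))))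

size-prefix : ∀ (xs ys : List ⟦ A ⟧) → size (list A) xs ≤ size (list A) (xs ++ ys)
size-prefix     []       ys = size-list-≥1 ys
size-prefix {A} (x ∷ xs) ys = s≤s (+-monoʳ-≤ (size A x) (size-prefix {A} xs ys))

size-suffix : ∀ (xs ys : List ⟦ A ⟧) → size (list A) ys ≤ size (list A) (xs ++ ys)
size-suffix     []       ys = ≤-refl
size-suffix {A} (x ∷ xs) ys = ≤-trans (size-suffix {A} xs ys) (≤-trans (m≤n+m _ (size A x)) (n≤1+n _))

size-foldl-cons : ∀ (xs acc : List ⟦ A ⟧) →
                  suc (size (list A) (foldl (flip _∷_) acc xs)) ≡ size (list A) xs + size (list A) acc
size-foldl-cons     []       acc = refl
size-foldl-cons {A} (x ∷ xs) acc = trans (size-foldl-cons {A} xs (x ∷ acc)) (trans (+-suc _ _) (cong suc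
  (trans (sym (+-assoc (size (list A) xs) _ _)) (cong (_+ size (list A) acc) (+-comm (size (list A) xs) (size A x))))))

size-reverse : ∀ (xs : List ⟦ A ⟧) → size (list A) (reverse xs) ≡ size (list A) xs
size-reverse {A} xs = suc-injective (trans (size-foldl-cons {A} xs []) (+-comm _ 1))

-- Polynomial-time functions

output-size : ∀ {p : Program A B} {x y t} → p ∙ x ⇓ y cost t → size B y ≤ t
output-size (op o x)       = m≤n+m _ _
output-size (p ⨾ q)        = ≤-trans (output-size q) (≤-trans (m≤n+m _ _) (n≤1+n _))
output-size (pair p q)     = s≤s (+-mono-≤ (output-size p) (output-size q))
output-size (match₁ p)     = ≤-trans (output-size p) (n≤1+n _)
output-size (match₂ q)     = ≤-trans (output-size q) (n≤1+n _)
output-size (stop p)       = ≤-trans (n≤1+n _) (≤-trans (output-size p) (n≤1+n _))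
output-size (continue p q) = ≤-trans (output-size q) (≤-trans (m≤n+m _ _) (n≤1+n _))

infix 2 _⇒_

-- Correctness arguments look only at `fun`, which is an ordinary function; the program and its
-- polynomial time bound are carried along by the combinators.
record _⇒_ (A B : Ty) : Set where
  field
    fun   : ⟦ A ⟧ → ⟦ B ⟧
    code  : Program A B
    time  : ⟦ A ⟧ → ℕ
    run   : ∀ x → code ∙ x ⇓ fun x cost time x
    time≲ : time ≲ size A

open _⇒_

size-fun : (f : A ⇒ B) → (λ x → size B (fun f x)) ≲ size A
size-fun f = ≲-mono (λ x → output-size (run f x)) (time≲ f)

abstract
  -- Every elementary operation adds at most a constant to the size. Multiplication is no exception,
  -- since bit lengths add up and both factors are counted in the argument.
  size-apply : (o : Op A B) → ∃ λ c → ∀ x → size B (apply o x) ≤ c + size A x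
  size-apply id      = 0 , λ x → ≤-refl
  size-apply fst     = 0 , λ (x , y) → ≤-trans (m≤m+n _ _) (n≤1+n _)
  size-apply snd     = 0 , λ (x , y) → ≤-trans (m≤n+m _ _) (n≤1+n _)
  size-apply inl     = 1 , λ x → ≤-refl
  size-apply inr     = 1 , λ x → ≤-refl
  size-apply drop    = 1 , λ x → s≤s z≤n
  size-apply nil     = 1 , λ x → s≤s z≤n
  size-apply cons    = 0 , λ x → ≤-refl
  size-apply uncons  = 1 , λ { [] → ≤-refl ; (x ∷ xs) → ≤-refl }
  size-apply (lit n) = size nat n , λ x → m≤m+n _ _
  size-apply add     = 0 , λ (m , n) → ≤-trans (size-+ m n) (n≤1+n _)
  size-apply sub     = 0 , λ (m , n) → ≤-trans (size-mono (m∸n≤m m n)) (≤-trans (m≤m+n _ _) (n≤1+n _))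
  size-apply mul     = 0 , λ (m , n) → ≤-trans (size-* m n) (n≤1+n _)
  size-apply div     = 0 , λ { (m , zero)  → s≤s z≤n
                             ; (m , suc n) → ≤-trans (size-mono (m/n≤m m (suc n))) (≤-trans (m≤m+n _ _) (n≤1+n _)) }
  size-apply leq     = 2 , λ (m , n) → leq-size m n
    where
    leq-size : ∀ m n → size (unit ⊕ unit) (apply leq (m , n)) ≤ 2 + size (nat ⊗ nat) (m , n)
    leq-size m n with m ≤? n
    ... | yes _ = s≤s (s≤s z≤n)
    ... | no  _ = s≤s (s≤s z≤n)

basic : Op A B → A ⇒ B
basic {A} o = record
  { fun   = apply o
  ; code  = op o
  ; run   = op o
  ; time≲ = ≲-+ ≲-measure (≲-mono (proj₂ (size-apply o)) (≲-+ (≲-const (proj₁ (size-apply o))) ≲-measure))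
  }

≲-fun : {X : Set} {m : X → ℕ} (f : ⟦ A ⟧ → ℕ) (h : X → ⟦ A ⟧) → f ≲ size A → (size A ∘ h) ≲ m → (f ∘ h) ≲ m
≲-fun f h (e , f≤) h≲ = ≲-mono (f≤ ∘ h) (≲-power e h≲)

infixr 4 _then_

_then_ : A ⇒ B → B ⇒ C → A ⇒ C
_then_ {A} {B} f g = record
  { fun   = fun g ∘ fun f
  ; code  = code f ⨾ code g
  ; run   = λ x → run f x ⨾ run g (fun f x)
  ; time≲ = ≲-suc (≲-+ (time≲ f) (≲-fun (time g) (fun f) (time≲ g) (size-fun f)))
  }

infixr 3 _&_

_&_ : A ⇒ B → A ⇒ C → A ⇒ B ⊗ C
f & g = record
  { fun   = λ x → fun f x , fun g x
  ; code  = pair (code f) (code g)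
  ; run   = λ x → pair (run f x) (run g x)
  ; time≲ = ≲-suc (≲-+ (time≲ f) (time≲ g))
  }

case : {X Y Z : Set} → X ⊎ Y → (X → Z) → (Y → Z) → Z
case (inj₁ x) f g = f x
case (inj₂ y) f g = g y

matching : A ⊗ C ⇒ D → B ⊗ C ⇒ D → (A ⊕ B) ⊗ C ⇒ D
matching {A} {C} {D} {B} f g = record
  { fun   = λ (x , w) → case x (λ a → fun f (a , w)) (λ b → fun g (b , w))
  ; code  = match (code f) (code g)
  ; time  = λ (x , w) → suc (case x (λ a → time f (a , w)) (λ b → time g (b , w)))
  ; run   = λ { (inj₁ a , w) → match₁ (run f (a , w)) ; (inj₂ b , w) → match₂ (run g (b , w)) }
  ; time≲ = ≲-suc (≲-mono
      -- The bound of a branch is in terms of the untagged pair, whose size is one less than that of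
      -- the input. Adding the polynomials of both branches gives one bound for either case.
      (λ { (inj₁ a , w) → ≤-trans (proj₂ (time≲ f) (a , w)) (≤-trans (^-monoˡ-≤ (proj₁ (time≲ f)) (+-monoʳ-≤ 3 (n≤1+n _))) (m≤m+n _ _))
         ; (inj₂ b , w) → ≤-trans (proj₂ (time≲ g) (b , w)) (≤-trans (^-monoˡ-≤ (proj₁ (time≲ g)) (+-monoʳ-≤ 3 (n≤1+n _))) (m≤n+m _ _)) })
      (≲-+ (≲-power (proj₁ (time≲ f)) ≲-measure) (≲-power (proj₁ (time≲ g)) ≲-measure)))
  }

-- Contexts are nested to the left: Γ ⊗ A extends Γ by a variable of type A.

var₀ : Γ ⊗ A ⇒ A
var₀ = basic snd

var₁ : (Γ ⊗ A) ⊗ B ⇒ A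
var₁ = basic fst then basic snd

var₂ : ((Γ ⊗ A) ⊗ B) ⊗ C ⇒ A
var₂ = basic fst then var₁

weaken : Γ ⇒ B → Γ ⊗ A ⇒ B
weaken f = basic fst then f

binary : Op (A ⊗ B) C → Γ ⇒ A → Γ ⇒ B → Γ ⇒ C
binary o f g = (f & g) then basic o

caseOf : Γ ⇒ A ⊕ B → Γ ⊗ A ⇒ C → Γ ⊗ B ⇒ C → Γ ⇒ C
caseOf h f g = (h & basic id) then matching (swap then f) (swap then g)
  where
  swap : A ⊗ Γ ⇒ Γ ⊗ A
  swap = basic snd & basic fst

if≤ : {X : Set} → ℕ × ℕ → X → X → X
if≤ p x y = case (apply leq p) (λ _ → x) (λ _ → y)

if≤-yes : ∀ {X : Set} {m n} {x y : X} → m ≤ n → if≤ (m , n) x y ≡ x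
if≤-yes {m = m} {n} m≤n with m ≤? n
... | yes _   = refl
... | no  m≰n = contradiction m≤n m≰n

if≤-no : ∀ {X : Set} {m n} {x y : X} → m ≰ n → if≤ (m , n) x y ≡ y
if≤-no {m = m} {n} m≰n with m ≤? n
... | yes m≤n = contradiction m≤n m≰n
... | no  _   = refl

ifLeq : Γ ⇒ nat ⊗ nat → Γ ⇒ A → Γ ⇒ A → Γ ⇒ A
ifLeq h f g = caseOf (h then basic leq) (weaken f) (weaken g)

infixr 5 _::_

_::_ : Γ ⇒ A → Γ ⇒ list A → Γ ⇒ list A
x :: xs = binary cons x xs

-- A polynomial step that is iterated may square its accumulator each time, so no bound follows from
-- `step` alone. The accumulators that the loop meets are the folds over prefixes `ys`, and it is
-- these that must stay below `b`.
foldl′ : (z : Γ ⇒ S) (l : Γ ⇒ list A) (step : (Γ ⊗ S) ⊗ A ⇒ S) (b : ⟦ Γ ⟧ → ℕ) →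
         let f γ s a = fun step ((γ , s) , a) in
         (∀ γ ys zs → fun l γ ≡ ys ++ zs → size S (foldl (f γ) (fun z γ) ys) ≤ b γ) →
         b ≲ size Γ → Γ ⇒ S
foldl′ {Γ} {S} {A} z l step b bounded b≲ = record
  { fun   = λ γ → foldl (f γ) (fun z γ) (fun l γ)
  ; code  = code initial ⨾ loop (code body)
  ; run   = λ γ → run initial γ ⨾ run-loop γ (fun z γ) (fun l γ)
  ; time≲ = ≲-suc (≲-+ (time≲ initial) (≲-mono
      (λ γ → loopTime-bound γ (b γ) (size (list A) (fun l γ)) (fun z γ) (fun l γ) ≤-refl (bounded γ))
      (≲-* (≲-suc (≲-mono (λ γ → <⇒≤ (length<size {A} (fun l γ))) (size-fun l)))
           (≲-suc (≲-power e (≲-suc (≲-+ (≲-suc (≲-+ ≲-measure b≲)) (size-fun l))))))))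
  }
  where
  f : ⟦ Γ ⟧ → ⟦ S ⟧ → ⟦ A ⟧ → ⟦ S ⟧
  f γ s a = fun step ((γ , s) , a)

  State : Ty
  State = (Γ ⊗ S) ⊗ list A

  initial : Γ ⇒ State
  initial = (basic id & z) & l

  body : State ⇒ State ⊕ S
  body = caseOf (basic snd then basic uncons)
    (var₂ then basic inr)
    ((((weaken (basic fst then basic fst)) &
       ((weaken (basic fst) & (var₀ then basic fst)) then step)) &
      (var₀ then basic snd))
     then basic inl)

  e : ℕ
  e = proj₁ (time≲ body)

  loopTime : ⟦ Γ ⟧ → ⟦ S ⟧ → ⟦ list A ⟧ → ℕ
  loopTime γ s []       = suc (time body ((γ , s) , []))
  loopTime γ s (a ∷ as) = suc (time body ((γ , s) , a ∷ as) + loopTime γ (f γ s a) as)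

  run-loop : ∀ γ s as → loop (code body) ∙ ((γ , s) , as) ⇓ foldl (f γ) s as cost loopTime γ s as
  run-loop γ s []       = stop (run body ((γ , s) , []))
  run-loop γ s (a ∷ as) = continue (run body ((γ , s) , a ∷ as)) (run-loop γ (f γ s a) as)

  stateSize : ℕ → ℕ → ℕ → ℕ
  stateSize g s l = suc (suc (g + s) + l)

  -- One round per element and a last one on the empty list, each charged as if on the largest
  -- state. The sizes `b` and `c` are fixed beforehand, so they do not change while the list
  -- shrinks.
  loopTime-bound : ∀ γ b c s as → size (list A) as ≤ c →
    (∀ ys zs → as ≡ ys ++ zs → size S (foldl (f γ) s ys) ≤ b) →
    loopTime γ s as ≤ suc (length as) * suc ((2 + stateSize (size Γ γ) b c) ^ e)
  loopTime-bound γ b c s as as≤c s≤b = go s as as≤c s≤b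
    where
    body-time : ∀ s as → size S s ≤ b → size (list A) as ≤ c →
                time body ((γ , s) , as) ≤ (2 + stateSize (size Γ γ) b c) ^ e
    body-time s as s≤b as≤c = ≤-trans (proj₂ (time≲ body) ((γ , s) , as))
      (^-monoˡ-≤ e (s≤s (s≤s (s≤s (+-mono-≤ (s≤s (+-monoʳ-≤ (size Γ γ) s≤b)) as≤c)))))

    go : ∀ s as → size (list A) as ≤ c →
         (∀ ys zs → as ≡ ys ++ zs → size S (foldl (f γ) s ys) ≤ b) →
         loopTime γ s as ≤ suc (length as) * suc ((2 + stateSize (size Γ γ) b c) ^ e)
    go s []       as≤c s≤b = s≤s (≤-trans (body-time s [] (s≤b [] [] refl) as≤c) (m≤m+n _ _))
    go s (a ∷ as) as≤c s≤b = s≤s (+-mono-≤ (body-time s (a ∷ as) (s≤b [] _ refl) as≤c)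
      (go (f γ s a) as (≤-trans (size-suffix {A} (a ∷ []) as) as≤c)
          (λ ys zs eq → s≤b (a ∷ ys) zs (cong (a ∷_) eq))))

reversed : Γ ⇒ list A → Γ ⇒ list A
reversed {Γ} {A} l = foldl′ (basic nil) l (var₀ :: var₁)
  (λ γ → size (list A) (fun l γ))
  (λ γ ys zs eq → subst₂ _≤_ (sym (size-reverse {A} ys)) (cong (size (list A)) (sym eq)) (size-prefix {A} ys zs))
  (size-fun l)

-- Runs as a left fold over the reversed list. The bound is asked for all lists no larger than the
-- input, rather than for its suffixes only, so that instances can argue by size without knowing
-- where a list comes from.
foldr′ : (z : Γ ⇒ S) (l : Γ ⇒ list A) (step : (Γ ⊗ A) ⊗ S ⇒ S) (b : ⟦ Γ ⟧ → ℕ) →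
         (∀ γ ys → size (list A) ys ≤ size (list A) (fun l γ) →
            size S (foldr (λ a s → fun step ((γ , a) , s)) (fun z γ) ys) ≤ b γ) →
         b ≲ size Γ → Γ ⇒ S
foldr′ {Γ} {S} {A} z l step b bounded b≲ = record folded
  { fun = λ γ → foldr (f γ) (fun z γ) (fun l γ)
  ; run = λ γ → subst (λ s → code folded ∙ γ ⇓ s cost time folded γ)
                      (reverse-foldl (flip (f γ)) (fun z γ) (fun l γ)) (run folded γ)
  }
  where
  f : ⟦ Γ ⟧ → ⟦ A ⟧ → ⟦ S ⟧ → ⟦ S ⟧
  f γ a s = fun step ((γ , a) , s)

  folded : Γ ⇒ S
  folded = foldl′ z (reversed l) (((weaken (basic fst) & var₀) & var₁) then step) b
    (λ γ ys zs eq → subst (λ s → size S s ≤ b γ)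
      (trans (sym (reverse-foldl (flip (f γ)) (fun z γ) (reverse ys)))
             (cong (foldl (flip (f γ)) (fun z γ)) (reverse-involutive ys)))
      (bounded γ (reverse ys) (subst₂ _≤_ (sym (size-reverse {A} ys))
        (trans (cong (size (list A)) (sym eq)) (size-reverse {A} (fun l γ))) (size-prefix {A} ys zs))))
    b≲

-- Lists

-- Exchanges the function for a pointwise equal specification and keeps program and time, so that
-- later proofs meet the specification instead of the function that the combinators produce.
_computing_by_ : (f : A ⇒ B) (g : ⟦ A ⟧ → ⟦ B ⟧) → (∀ x → fun f x ≡ g x) → A ⇒ B
f computing g by f≗g = record f
  { fun = g
  ; run = λ x → subst (λ y → code f ∙ x ⇓ y cost time f x) (f≗g x) (run f x)
  }

size-∈ : ∀ {a} {xs : List ⟦ A ⟧} → a ∈ xs → size A a ≤ size (list A) xs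
size-∈ (here refl) = ≤-trans (m≤m+n _ _) (n≤1+n _)
size-∈ (there a∈)  = ≤-trans (size-∈ a∈) (≤-trans (m≤n+m _ _) (n≤1+n _))

size-list≤ : ∀ {b} (xs : List ⟦ A ⟧) → (∀ {a} → a ∈ xs → size A a ≤ b) → size (list A) xs ≤ suc (length xs) * suc b
size-list≤     []       _   = s≤s z≤n
size-list≤ {A} {b} (x ∷ xs) xs≤ = s≤s (+-mono-≤ (xs≤ (here refl)) (size-list≤ {A} {b} xs (xs≤ ∘ there)))

-- The accumulator holds at most one result per element, and an element is no larger than its list;
-- hence the product bound.
mapF : Γ ⊗ A ⇒ B → Γ ⇒ list A → Γ ⇒ list B
mapF {Γ} {A} {B} f l = foldr′ (basic nil) l ((basic fst then f) :: var₀)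
  (λ γ → suc (size (list A) (fun l γ)) * suc (elementBound γ))
  (λ γ ys ys≤ → subst (λ zs → size (list B) zs ≤ _) (map-is-foldr ys) (map-size γ ys ys≤))
  (≲-* (≲-suc (size-fun l)) (≲-suc (≲-power e (≲-suc (≲-+ ≲-measure (size-fun l))))))
  computing (λ γ → map (λ a → fun f (γ , a)) (fun l γ))
  by (λ γ → sym (map-is-foldr (fun l γ)))
  where
  e : ℕ
  e = proj₁ (size-fun f)
  elementBound : ⟦ Γ ⟧ → ℕ
  elementBound γ = (2 + suc (size Γ γ + size (list A) (fun l γ))) ^ e
  map-size : ∀ γ ys → size (list A) ys ≤ size (list A) (fun l γ) →
             size (list B) (map (λ a → fun f (γ , a)) ys) ≤ suc (size (list A) (fun l γ)) * suc (elementBound γ)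
  map-size γ ys ys≤ = ≤-trans
    (size-list≤ {B} _ λ b∈ → elements b∈)
    (*-monoˡ-≤ (suc (elementBound γ)) (s≤s (≤-trans (≤-reflexive (length-map _ ys)) (≤-trans (<⇒≤ (length<size {A} ys)) ys≤))))
    where
    elements : ∀ {b} → b ∈ map (λ a → fun f (γ , a)) ys → size B b ≤ elementBound γ
    elements b∈ with ∈-map⁻ _ b∈
    ... | a , a∈ , refl = ≤-trans (proj₂ (size-fun f) (γ , a))
      (^-monoˡ-≤ e (s≤s (s≤s (s≤s (+-monoʳ-≤ (size Γ γ) (≤-trans (size-∈ a∈) ys≤))))))

infixr 5 _+++_

_+++_ : Γ ⇒ list A → Γ ⇒ list A → Γ ⇒ list A
_+++_ {Γ} {A} xs ys = foldr′ ys xs (var₁ :: var₀)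
  (λ γ → size (list A) (fun xs γ) + size (list A) (fun ys γ))
  (λ γ zs zs≤ → subst (λ s → size (list A) s ≤ _) (++-is-foldr zs (fun ys γ))
    (≤-trans (<⇒≤ (size-++ {A} zs (fun ys γ))) (+-monoˡ-≤ _ zs≤)))
  (≲-+ (size-fun xs) (size-fun ys))
  computing (λ γ → fun xs γ ++ fun ys γ)
  by (λ γ → sym (++-is-foldr (fun xs γ) (fun ys γ)))

size-concat : ∀ (xss : List (List ⟦ A ⟧)) → size (list A) (concat xss) ≤ size (list (list A)) xss
size-concat     []         = ≤-refl
size-concat {A} (xs ∷ xss) = ≤-trans (<⇒≤ (size-++ {A} xs (concat xss))) (≤-trans (+-monoʳ-≤ _ (size-concat {A} xss)) (n≤1+n _))

concatF : Γ ⇒ list (list A) → Γ ⇒ list A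
concatF {Γ} {A} l = foldr′ (basic nil) l (var₁ +++ var₀)
  (λ γ → size (list (list A)) (fun l γ))
  (λ γ ys ys≤ → ≤-trans (≤-trans (≤-reflexive (cong (size (list A)) (foldr≡concat ys))) (size-concat {A} ys)) ys≤)
  (size-fun l)
  computing (λ γ → concat (fun l γ))
  by (λ γ → foldr≡concat (fun l γ))
  where
  foldr≡concat : ∀ (ys : List (List ⟦ A ⟧)) → foldr (λ xs s → xs ++ s) [] ys ≡ concat ys
  foldr≡concat []       = refl
  foldr≡concat (y ∷ ys) = cong (y ++_) (foldr≡concat ys)

concatMapF : Γ ⊗ A ⇒ list B → Γ ⇒ list A → Γ ⇒ list B
concatMapF f l = concatF (mapF f l)

filterLeq : {X : Set} → (X → ℕ × ℕ) → List X → List X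
filterLeq h = concatMap (λ a → if≤ (h a) (a ∷ []) [])

filterLeqF : Γ ⊗ A ⇒ nat ⊗ nat → Γ ⇒ list A → Γ ⇒ list A
filterLeqF h l = concatMapF (ifLeq h (var₀ :: basic nil) (basic nil)) l
  computing (λ γ → filterLeq (λ a → fun h (γ , a)) (fun l γ))
  by (λ γ → refl)

∈-filterLeq⁺ : ∀ {X : Set} (h : X → ℕ × ℕ) {a xs} → a ∈ xs → proj₁ (h a) ≤ proj₂ (h a) → a ∈ filterLeq h xs
∈-filterLeq⁺ h {a} a∈ h≤ = ∈-concatMap⁺ _ (lose a∈ (subst (a ∈_) (sym (if≤-yes h≤)) (here refl)))

∈-filterLeq⁻ : ∀ {X : Set} (h : X → ℕ × ℕ) {a xs} → a ∈ filterLeq h xs → a ∈ xs × proj₁ (h a) ≤ proj₂ (h a)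
∈-filterLeq⁻ h {a} {xs} a∈ with find (∈-concatMap⁻ (λ a → if≤ (h a) (a ∷ []) []) a∈)
... | b , b∈ , a∈b with proj₁ (h b) ≤? proj₂ (h b)
...   | no  _ with () ← a∈b
...   | yes h≤ with here refl ← a∈b = b∈ , h≤

ifEq : Γ ⇒ nat → Γ ⇒ nat → Γ ⇒ A → Γ ⇒ A → Γ ⇒ A
ifEq m n f g = ifLeq (m & n) (ifLeq (n & m) f g) g

if≡ : {X : Set} → ℕ → ℕ → X → X → X
if≡ m n x y = if≤ (m , n) (if≤ (n , m) x y) y

if≡-yes : ∀ {X : Set} n {x y : X} → if≡ n n x y ≡ x
if≡-yes n = trans (if≤-yes {m = n} ≤-refl) (if≤-yes {m = n} ≤-refl)

if≡-no : ∀ {X : Set} {m n} {x y : X} → m ≢ n → if≡ m n x y ≡ y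
if≡-no {m = m} {n} m≢n with m ≤? n
... | no  m≰n = refl
... | yes m≤n = if≤-no (m≢n ∘ ≤-antisym m≤n)

-- A range is drawn from the shape of a list, never from a binary number, whose range could be
-- exponentially long in its size.
indices : {X : Set} → List X → List ℕ
indices = foldr (λ _ is → 0 ∷ map ℕ.suc is) []

length-indices : ∀ {X : Set} (xs : List X) → length (indices xs) ≡ length xs
length-indices []       = refl
length-indices (x ∷ xs) = cong suc (trans (length-map ℕ.suc (indices xs)) (length-indices xs))

∈-indices⁺ : ∀ {X : Set} {xs : List X} {i} → i < length xs → i ∈ indices xs
∈-indices⁺ {xs = x ∷ xs} {zero}  _         = here refl
∈-indices⁺ {xs = x ∷ xs} {suc i} (s≤s i<n) = there (∈-map⁺ ℕ.suc (∈-indices⁺ {xs = xs} i<n))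

∈-indices⁻ : ∀ {X : Set} (xs : List X) {i} → i ∈ indices xs → i < length xs
∈-indices⁻ (x ∷ xs) (here refl) = s≤s z≤n
∈-indices⁻ (x ∷ xs) (there i∈) with ∈-map⁻ ℕ.suc i∈
... | j , j∈ , refl = s≤s (∈-indices⁻ xs j∈)

indices-tabulate : ∀ {X : Set} {n} (f : Fin n → X) → indices (tabulate f) ≡ tabulate {n = n} toℕ
indices-tabulate {n = zero}  f = refl
indices-tabulate {n = suc n} f = cong (0 ∷_) (trans (cong (map ℕ.suc) (indices-tabulate (f ∘ suc))) (map-tabulate {n = n} toℕ suc))

indicesF : Γ ⇒ list A → Γ ⇒ list nat
indicesF {Γ} {A} l = foldr′ (basic nil) l (basic (lit 0) :: mapF (binary add (basic (lit 1)) var₀) var₀)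
  (λ γ → suc (s γ) * suc (suc (s γ)))
  (λ γ ys ys≤ → let l≤s = ≤-trans (<⇒≤ (length<size {A} ys)) ys≤ in ≤-trans
    (size-list≤ {nat} (indices ys) (λ {i} i∈ → ≤-trans (size≤1+n i) (≤-trans (∈-indices⁻ ys i∈) l≤s)))
    (*-mono-≤ (s≤s (≤-trans (≤-reflexive (length-indices ys)) l≤s)) (n≤1+n _)))
  (≲-* (≲-suc (size-fun l)) (≲-suc (≲-suc (size-fun l))))
  where
  s : ⟦ Γ ⟧ → ℕ
  s γ = size (list A) (fun l γ)

lengthF : Γ ⇒ list A → Γ ⇒ nat
lengthF {Γ} {A} l = foldr′ (basic (lit 0)) l (binary add (basic (lit 1)) var₀)
  (λ γ → size (list A) (fun l γ))
  (λ γ ys ys≤ → ≤-trans (≤-reflexive (cong (size nat) (foldr≡length ys)))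
                 (≤-trans (size≤1+n (length ys)) (≤-trans (length<size {A} ys) ys≤)))
  (size-fun l)
  computing (λ γ → length (fun l γ))
  by (λ γ → foldr≡length (fun l γ))
  where
  foldr≡length : ∀ {X : Set} (ys : List X) → foldr (λ _ n → 1 + n) 0 ys ≡ length ys
  foldr≡length []       = refl
  foldr≡length (y ∷ ys) = cong suc (foldr≡length ys)

module _ {X Y : Set} where

  zipStep : X → List Y × List (X × Y) → List Y × List (X × Y)
  zipStep x ([]     , zs) = [] , zs
  zipStep x (y ∷ ys , zs) = ys , (x , y) ∷ zs

  -- Consuming ys backwards aligns the two lists at their ends, which
  -- for lists of equal length is the usual zip.
  zipEnds : List X → List Y → List (X × Y)
  zipEnds xs ys = proj₂ (foldr zipStep (reverse ys , []) xs)

  zipEnds-tabulate : ∀ {n} (f : Fin n → X) (g : Fin n → Y) →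
                     zipEnds (tabulate f) (tabulate g) ≡ tabulate (λ i → f i , g i)
  zipEnds-tabulate f g = cong proj₂ (aligned f g [])
    where
    -- Reversal is generalised to an arbitrary accumulator `rest`: the entries of `g` are pushed
    -- onto it, and the fold over `f` pops exactly these again.
    aligned : ∀ {n} (f : Fin n → X) (g : Fin n → Y) rest →
              foldr zipStep (foldl (flip _∷_) rest (tabulate g) , []) (tabulate f) ≡ (rest , tabulate (λ i → f i , g i))
    aligned {zero}  f g rest = refl
    aligned {suc n} f g rest = cong (zipStep (f zero)) (aligned (f ∘ suc) (g ∘ suc) (g zero ∷ rest))

zipF : Γ ⇒ list A → Γ ⇒ list B → Γ ⇒ list (A ⊗ B)
zipF {Γ} {A} {B} xs ys = (foldr′ (reversed ys & basic nil) xs step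
  (λ γ → suc (size (list A) (fun xs γ) + size (list B) (reverse (fun ys γ))))
  (λ γ zs zs≤ → subst (λ s → size _ s ≤ _) (sym (foldr-cong (λ a s → step≡zipStep γ a s) refl zs))
     (s≤s (≤-trans (zip-size zs (reverse (fun ys γ))) (+-monoˡ-≤ _ zs≤))))
  (≲-suc (≲-+ (size-fun xs) (size-fun (reversed ys))))
  then basic snd)
  computing (λ γ → zipEnds (fun xs γ) (fun ys γ))
  by (λ γ → cong proj₂ (foldr-cong (λ a s → step≡zipStep γ a s) refl (fun xs γ)))
  where
  step : (Γ ⊗ A) ⊗ (list B ⊗ list (A ⊗ B)) ⇒ list B ⊗ list (A ⊗ B)
  step = caseOf (var₀ then basic fst then basic uncons)
    (basic nil & (var₁ then basic snd))
    ((var₀ then basic snd) & ((var₂ & (var₀ then basic fst)) :: (var₁ then basic snd)))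

  step≡zipStep : ∀ γ x s → fun step ((γ , x) , s) ≡ zipStep x s
  step≡zipStep γ x ([]     , zs) = refl
  step≡zipStep γ x (y ∷ ys , zs) = refl

  -- Each step moves one element from the unread list to the output, so the sum of the two sizes is
  -- the quantity that stays controlled.
  zip-size : ∀ xs rest → let (ys , zs) = foldr zipStep (rest , []) xs in
             size (list B) ys + size (list (A ⊗ B)) zs ≤ size (list A) xs + size (list B) rest
  zip-size []       rest = ≤-reflexive (+-comm _ 1)
  zip-size (x ∷ xs) rest with foldr zipStep (rest , []) xs | zip-size xs rest
  ... | []     , zs | ih = ≤-trans ih (+-monoˡ-≤ _ (≤-trans (m≤n+m _ (size A x)) (n≤1+n _)))
  ... | y ∷ ys , zs | ih = begin
    size (list B) ys + suc (suc (a + b) + z)     ≡⟨ solve 4 (λ a b y z → y :+ (con 1 :+ (con 1 :+ (a :+ b) :+ z)) := con 1 :+ a :+ (con 1 :+ (b :+ y) :+ z)) refl a b (size (list B) ys) z ⟩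
    suc a + (size (list B) (y ∷ ys) + z)         ≤⟨ +-monoʳ-≤ (suc a) ih ⟩
    suc a + (size (list A) xs + size (list B) rest)  ≡⟨ +-assoc (suc a) _ _ ⟨
    size (list A) (x ∷ xs) + size (list B) rest  ∎
    where
    open ≤-Reasoning
    open +-*-Solver
    a b z : ℕ
    a = size A x
    b = size B y
    z = size (list (A ⊗ B)) zs

module _ {X : Set} where

  select : ℕ → ℕ × X → X → X
  select i (j , x) s = if≡ j i x s

  -- Lookup is a fold over the entries labelled by their positions, a form that `foldr′` can run; as
  -- positions are distinct, only one entry can match.
  nth : X → ℕ → List X → X
  nth d i xs = foldr (select i) d (zipEnds (indices xs) xs)

  nth-tabulate : ∀ {n} d (f : Fin n → X) i → nth d (toℕ i) (tabulate f) ≡ f i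
  nth-tabulate {n} d f i = begin
    foldr (select (toℕ i)) d (zipEnds (indices (tabulate f)) (tabulate f))
      ≡⟨ cong (λ is → foldr (select (toℕ i)) d (zipEnds is (tabulate f))) (indices-tabulate f) ⟩
    foldr (select (toℕ i)) d (zipEnds (tabulate {n = n} toℕ) (tabulate f))
      ≡⟨ cong (foldr (select (toℕ i)) d) (zipEnds-tabulate toℕ f) ⟩
    foldr (select (toℕ i)) d (tabulate (λ j → toℕ j , f j))
      ≡⟨ keyed toℕ f toℕ-injective i ⟩
    f i ∎
    where
    open ≡-Reasoning
    -- Stated for any injective key, because the keys in the tail of the table are shifted and no
    -- longer `toℕ`.
    keyed : ∀ {n} (key : Fin n → ℕ) (f : Fin n → X) → (∀ {i j} → key i ≡ key j → i ≡ j) →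
            ∀ i → foldr (select (key i)) d (tabulate (λ j → key j , f j)) ≡ f i
    keyed key f inj zero    = if≡-yes (key zero)
    keyed key f inj (suc i) = trans (if≡-no (λ eq → Finₚ.0≢1+n (inj eq)))
                                    (keyed (key ∘ suc) (f ∘ suc) (Finₚ.suc-injective ∘ inj) i)

  foldr-select : ∀ d i xs → foldr (select i) d xs ≡ d ⊎ (∃ λ j → (j , foldr (select i) d xs) ∈ xs)
  foldr-select d i []             = inj₁ refl
  foldr-select d i ((j , x) ∷ xs) with j ≤? i
  ... | no  _ = rest
    where
    rest : foldr (select i) d xs ≡ d ⊎ (∃ λ k → (k , foldr (select i) d xs) ∈ (j , x) ∷ xs)
    rest = Sum.map₂ (λ (k , k∈) → k , there k∈) (foldr-select d i xs)
  ... | yes _ with i ≤? j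
  ...   | yes _ = inj₂ (j , here refl)
  ...   | no  _ = Sum.map₂ (λ (k , k∈) → k , there k∈) (foldr-select d i xs)

nthF : Γ ⇒ A → Γ ⇒ nat → Γ ⇒ list A → Γ ⇒ A
nthF {Γ} {A} d i l = foldr′ d (zipF (indicesF l) l)
  (ifEq (var₁ then basic fst) (weaken (weaken i)) (var₁ then basic snd) var₀)
  (λ γ → size A (fun d γ) + size (list (nat ⊗ A)) (keyed γ))
  (λ γ ys ys≤ → bounded γ ys ys≤ (foldr-select (fun d γ) (fun i γ) ys))
  (≲-+ (size-fun d) (size-fun (zipF (indicesF l) l)))
  where
  keyed : ⟦ Γ ⟧ → List (ℕ × ⟦ A ⟧)
  keyed γ = zipEnds (indices (fun l γ)) (fun l γ)

  bounded : ∀ γ ys → size (list (nat ⊗ A)) ys ≤ size (list (nat ⊗ A)) (keyed γ) →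
    let x = foldr (select (fun i γ)) (fun d γ) ys in
    x ≡ fun d γ ⊎ (∃ λ j → (j , x) ∈ ys) → size A x ≤ size A (fun d γ) + size (list (nat ⊗ A)) (keyed γ)
  bounded γ ys ys≤ (inj₁ eq)       = ≤-trans (≤-reflexive (cong (size A) eq)) (m≤m+n _ _)
  bounded γ ys ys≤ (inj₂ (j , x∈)) = ≤-trans (m≤n+m _ (suc (size nat j)))
    (≤-trans (size-∈ {nat ⊗ A} x∈) (≤-trans ys≤ (m≤n+m _ _)))

module _ {X : Set} where

  minStep : ℕ × X → ⊤ ⊎ (ℕ × X) → ⊤ ⊎ (ℕ × X)
  minStep a s = case s (λ _ → inj₂ a) (λ b → if≤ (proj₁ a , proj₁ b) (inj₂ a) (inj₂ b))

  minBy : List (ℕ × X) → ⊤ ⊎ (ℕ × X)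
  minBy = foldr minStep (inj₁ tt)

  data Minimum (xs : List (ℕ × X)) : ⊤ ⊎ (ℕ × X) → Set where
    none : xs ≡ [] → Minimum xs (inj₁ tt)
    some : ∀ {a} → a ∈ xs → (∀ {b} → b ∈ xs → proj₁ a ≤ proj₁ b) → Minimum xs (inj₂ a)

  minBy-minimum : ∀ xs → Minimum xs (minBy xs)
  minBy-minimum []       = none refl
  minBy-minimum (a ∷ xs) with minBy xs | minBy-minimum xs
  ... | inj₁ _ | none refl      = some (here refl) λ { (here refl) → ≤-refl }
  ... | inj₂ b | some b∈ b≤ with proj₁ a ≤? proj₁ b
  ...   | yes a≤b = some (here refl) λ { (here refl) → ≤-refl ; (there c∈) → ≤-trans a≤b (b≤ c∈) }
  ...   | no  a≰b = some (there b∈) λ { (here refl) → <⇒≤ (≰⇒> a≰b) ; (there c∈) → b≤ c∈ }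

minByF : Γ ⇒ list (nat ⊗ A) → Γ ⇒ unit ⊕ nat ⊗ A
minByF {Γ} {A} l = foldr′ (basic drop then basic inl) l
  (caseOf var₀ (weaken var₁ then basic inr)
    (ifLeq ((var₂ then basic fst) & (var₀ then basic fst)) (var₂ then basic inr) (var₀ then basic inr)))
  (λ γ → suc (size (list (nat ⊗ A)) (fun l γ)))
  (λ γ ys ys≤ → bounded γ ys ys≤ (minBy-minimum ys))
  (≲-suc (size-fun l))
  where
  bounded : ∀ γ ys {m} → size (list (nat ⊗ A)) ys ≤ size (list (nat ⊗ A)) (fun l γ) → Minimum ys m →
            size (unit ⊕ nat ⊗ A) m ≤ suc (size (list (nat ⊗ A)) (fun l γ))
  bounded γ ys ys≤ (none _)    = s≤s (size-list-≥1 {nat ⊗ A} (fun l γ))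
  bounded γ ys ys≤ (some a∈ _) = s≤s (≤-trans (size-∈ {nat ⊗ A} a∈) ys≤)

-- The multiple-choice knapsack problem

Chosen : {X : Set} → List X → List (List X) → Set
Chosen = Pointwise _∈_

size-chosen : ∀ {os iss} → Chosen os iss → size (list A) os ≤ size (list (list A)) iss
size-chosen []         = ≤-refl
size-chosen (o∈ ∷ os∈) = s≤s (+-mono-≤ (size-∈ o∈) (size-chosen os∈))

chosen-map : ∀ {X Y : Set} (f : X → Y) {os iss} → Chosen os iss → Chosen (map f os) (map (map f) iss)
chosen-map f []         = []
chosen-map f (o∈ ∷ os∈) = ∈-map⁺ f o∈ ∷ chosen-map f os∈

chosen-unmap : ∀ {X Y : Set} (f : X → Y) {os} iss → Chosen os (map (map f) iss) →
               ∃ λ os′ → os ≡ map f os′ × Chosen os′ iss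
chosen-unmap f []         []         = [] , refl , []
chosen-unmap f (is ∷ iss) (o∈ ∷ os∈) with ∈-map⁻ f o∈ | chosen-unmap f iss os∈
... | o′ , o′∈ , refl | os′ , refl , os′∈ = o′ ∷ os′ , refl , o′∈ ∷ os′∈

length-concatMap : ∀ {X Y : Set} (f : X → List Y) c xs → (∀ x → length (f x) ≡ c) → length (concatMap f xs) ≡ length xs * c
length-concatMap f c []       eq = refl
length-concatMap f c (x ∷ xs) eq = trans (length-++ (f x)) (cong₂ _+_ (eq x) (length-concatMap f c xs eq))

-- The seed `z` ensures that some value is admissible. With seed 1 this picks the scale of the
-- rounding, with seed 0 the threshold on return times.
largest-below : ∀ xs {z w} → z ≤ w → ∃ λ g → g ∈ z ∷ xs × g ≤ w × (∀ {x} → x ∈ z ∷ xs → x ≤ w → x ≤ g)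
largest-below [] z≤w = _ , here refl , z≤w , λ { (here refl) _ → ≤-refl }
largest-below (x ∷ xs) {z} {w} z≤w with largest-below xs z≤w
... | g , g∈ , g≤w , below with x ≤? g | x ≤? w
...   | no  x≰g | yes x≤w = x , there (here refl) , x≤w , λ
  { (here refl) z≤w         → ≤-trans (below (here refl) z≤w) (<⇒≤ (≰⇒> x≰g))
  ; (there (here refl)) _   → ≤-refl
  ; (there (there y∈)) y≤w  → ≤-trans (below (there y∈) y≤w) (<⇒≤ (≰⇒> x≰g)) }
...   | no  x≰g | no  x≰w = g , insert g∈ , g≤w , λ
  { (here refl) z≤w         → below (here refl) z≤w
  ; (there (here refl)) x≤w → contradiction x≤w x≰w
  ; (there (there y∈)) y≤w  → below (there y∈) y≤w }
  where
  insert : g ∈ z ∷ xs → g ∈ z ∷ x ∷ xs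
  insert (here refl) = here refl
  insert (there g∈)  = there (there g∈)
...   | yes x≤g | _       = g , insert g∈ , g≤w , λ
  { (here refl) z≤w         → below (here refl) z≤w
  ; (there (here refl)) _   → x≤g
  ; (there (there y∈)) y≤w  → below (there y∈) y≤w }
  where
  insert : g ∈ z ∷ xs → g ∈ z ∷ x ∷ xs
  insert (here refl) = here refl
  insert (there g∈)  = there (there g∈)

module Knapsack (Λ : Ty) where

  -- weight, cost and label
  option : Ty
  option = nat ⊗ nat ⊗ Λ

  -- weight, key, cost and label; the key is the rounded cost
  keyed : Ty
  keyed = nat ⊗ nat ⊗ nat ⊗ Λ

  -- Weight, key, true cost and labels of a partial choice. Pruning looks at keys and weights only;
  -- the true cost is carried along so that the value reported in the end is exact.
  state : Ty
  state = nat ⊗ nat ⊗ nat ⊗ list Λ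

  key : ⟦ state ⟧ → ℕ
  key (_ , q , _) = q

  empty : ⟦ state ⟧
  empty = 0 , 0 , 0 , []

  extend : ⟦ keyed ⟧ → ⟦ state ⟧ → ⟦ state ⟧
  extend (w , q , c , l) (w′ , q′ , c′ , ls) = w + w′ , q + q′ , c + c′ , l ∷ ls

  total : List ⟦ keyed ⟧ → ⟦ state ⟧
  total = foldr extend empty

  -- A level acts as a budget on the key, and for each budget the lightest state survives, since
  -- `minBy` compares first components. The table thus never has more entries than there are levels.
  prune : List ℕ → List ⟦ state ⟧ → List ⟦ state ⟧
  prune levels ss = concatMap (λ q → case (minBy (filterLeq (λ s → key s , q) ss)) (λ _ → []) (_∷ [])) levels

  extendAll : List ⟦ keyed ⟧ → List ⟦ state ⟧ → List ⟦ state ⟧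
  extendAll os ss = concatMap (λ o → map (extend o) ss) os

  states : List ℕ → List (List ⟦ keyed ⟧) → List ⟦ state ⟧
  states levels = foldr (λ os ss → prune levels (extendAll os ss)) (empty ∷ [])

  prune-⊆ : ∀ levels ss {s} → s ∈ prune levels ss → s ∈ ss
  prune-⊆ levels ss s∈ with find (∈-concatMap⁻ (λ q → case (minBy (filterLeq (λ s → key s , q) ss)) (λ _ → []) (_∷ [])) {xs = levels} s∈)
  ... | q , q∈ , s∈q with minBy (filterLeq (λ s → key s , q) ss) | minBy-minimum (filterLeq (λ s → key s , q) ss) | s∈q
  ...   | inj₂ s | some s∈′ _ | here refl = proj₁ (∈-filterLeq⁻ (λ s → key s , q) {xs = ss} s∈′)

  prune-dominates : ∀ {levels ss t q} → t ∈ ss → key t ≤ q → q ∈ levels →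
                    ∃ λ s → s ∈ prune levels ss × key s ≤ q × proj₁ s ≤ proj₁ t
  prune-dominates {levels} {ss} {t} {q} t∈ t≤q q∈
    with minBy (filterLeq (λ s → key s , q) ss) in eq | minBy-minimum (filterLeq (λ s → key s , q) ss)
       | ∈-filterLeq⁺ (λ s → key s , q) t∈ t≤q
  ... | inj₁ _ | none ≡[] | t∈′ with () ← subst (t ∈_) ≡[] t∈′
  ... | inj₂ s | some s∈ s≤ | t∈′ =
    s , ∈-concatMap⁺ _ (lose q∈ (subst (λ m → s ∈ case m (λ _ → []) (_∷ [])) (sym eq) (here refl))) ,
    proj₂ (∈-filterLeq⁻ (λ s → key s , q) {xs = ss} s∈) , s≤ t∈′

  length-prune : ∀ levels ss → length (prune levels ss) ≤ length levels
  length-prune []       ss = z≤n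
  length-prune (q ∷ qs) ss with minBy (filterLeq (λ s → key s , q) ss)
  ... | inj₁ _ = ≤-trans (length-prune qs ss) (n≤1+n _)
  ... | inj₂ s = s≤s (length-prune qs ss)

  -- Serves the running time as well: as every state is the total of an actual choice, its size is
  -- linear in that of the items, which is what `size-states` needs.
  states-sound : ∀ levels iss {s} → s ∈ states levels iss → ∃ λ os → Chosen os iss × s ≡ total os
  states-sound levels []         (here refl) = [] , [] , refl
  states-sound levels (is ∷ iss) s∈
    with find (∈-concatMap⁻ (λ o → map (extend o) (states levels iss)) {xs = is} (prune-⊆ levels (extendAll is (states levels iss)) s∈))
  ... | o , o∈ , s∈o with ∈-map⁻ (extend o) s∈o
  ...   | s′ , s′∈ , refl with states-sound levels iss s′∈
  ...     | os , os∈ , refl = o ∷ os , o∈ ∷ os∈ , refl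

  -- Dominance in key and weight is preserved when both sides are extended by the same option, and
  -- pruning at the level equal to the key of the choice keeps a state at least as light. Every
  -- partial choice needs its own level, hence the hypothesis on all keys up to the total.
  states-complete : ∀ {levels iss os} → (∀ q → q ≤ key (total os) → q ∈ levels) → Chosen os iss →
                    ∃ λ s → s ∈ states levels iss × key s ≤ key (total os) × proj₁ s ≤ proj₁ (total os)
  states-complete level []                        = empty , here refl , z≤n , z≤n
  states-complete {os = o ∷ os} level (o∈ ∷ os∈)
    with states-complete (λ q q≤ → level q (≤-trans q≤ (m≤n+m _ _))) os∈
  ... | s , s∈ , key≤ , weight≤
    with prune-dominates {t = extend o s} (∈-concatMap⁺ _ (lose o∈ (∈-map⁺ (extend o) s∈)))
           (+-monoʳ-≤ _ key≤) (level (key (total (o ∷ os))) ≤-refl)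
  ...   | s′ , s′∈ , key′≤ , weight′≤ = s′ , s′∈ , key′≤ , ≤-trans weight′≤ (+-monoʳ-≤ _ weight≤)

  size-extend : ∀ o s → size state (extend o s) ≤ size keyed o + size state s
  size-extend (w , q , c , l) (w′ , q′ , c′ , ls) = begin
    size state (extend (w , q , c , l) (w′ , q′ , c′ , ls))
      ≤⟨ s≤s (+-mono-≤ (size-+ w w′) (s≤s (+-mono-≤ (size-+ q q′) (s≤s (+-monoˡ-≤ _ (size-+ c c′)))))) ⟩
    suc ((a₁ + b₁) + suc ((a₂ + b₂) + suc ((a₃ + b₃) + suc (a₄ + b₄))))
      ≤⟨ m≤n+m _ 2 ⟩
    2 + suc ((a₁ + b₁) + suc ((a₂ + b₂) + suc ((a₃ + b₃) + suc (a₄ + b₄))))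
      ≡⟨ solve 8 (λ a₁ a₂ a₃ a₄ b₁ b₂ b₃ b₄ →
           con 3 :+ ((a₁ :+ b₁) :+ (con 1 :+ ((a₂ :+ b₂) :+ (con 1 :+ ((a₃ :+ b₃) :+ (con 1 :+ (a₄ :+ b₄)))))))
           := (con 1 :+ (a₁ :+ (con 1 :+ (a₂ :+ (con 1 :+ (a₃ :+ a₄))))))
              :+ (con 1 :+ (b₁ :+ (con 1 :+ (b₂ :+ (con 1 :+ (b₃ :+ b₄)))))))
           refl a₁ a₂ a₃ a₄ b₁ b₂ b₃ b₄ ⟩
    size keyed (w , q , c , l) + size state (w′ , q′ , c′ , ls) ∎
    where
    open ≤-Reasoning
    open +-*-Solver
    a₁ a₂ a₃ a₄ b₁ b₂ b₃ b₄ : ℕ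
    a₁ = size nat w
    a₂ = size nat q
    a₃ = size nat c
    a₄ = size Λ l
    b₁ = size nat w′
    b₂ = size nat q′
    b₃ = size nat c′
    b₄ = size (list Λ) ls

  -- The state `empty` has size 7, of which 1 is already counted for the empty list.
  size-total : ∀ os → size state (total os) ≤ size (list keyed) os + 6
  size-total []       = ≤-refl
  size-total (o ∷ os) = ≤-trans (size-extend o (total os)) (≤-trans (+-monoʳ-≤ (size keyed o) (size-total os))
    (≤-trans (≤-reflexive (sym (+-assoc (size keyed o) _ 6))) (n≤1+n _)))

  size-states : ∀ levels iss → size (list state) (states levels iss) ≤
                (2 + length levels) * suc (size (list (list keyed)) iss + 6)
  size-states levels iss = ≤-trans
    (size-list≤ {state} (states levels iss) λ s∈ → element (states-sound levels iss s∈))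
    (*-monoˡ-≤ _ (s≤s (length-states iss)))
    where
    element : ∀ {s} → ∃ (λ os → Chosen os iss × s ≡ total os) → size state s ≤ size (list (list keyed)) iss + 6
    element (os , os∈ , refl) = ≤-trans (size-total os) (+-monoˡ-≤ 6 (size-chosen {keyed} os∈))
    length-states : ∀ iss → length (states levels iss) ≤ suc (length levels)
    length-states []         = s≤s z≤n
    length-states (is ∷ iss) = ≤-trans (length-prune levels (extendAll is (states levels iss))) (n≤1+n _)

  statesF : Γ ⇒ list nat → Γ ⇒ list (list keyed) → Γ ⇒ list state
  statesF {Γ} levels iss = foldr′ (((basic (lit 0)) & (basic (lit 0)) & (basic (lit 0)) & (basic nil)) :: basic nil) iss
    (concatMapF
      (caseOf (minByF (filterLeqF ((var₀ then basic snd then basic fst) & var₁) allExtended)) (basic nil) (var₀ :: basic nil))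
      (weaken (weaken levels)))
    (λ γ → (2 + size (list nat) (fun levels γ)) * suc (size (list (list keyed)) (fun iss γ) + 6))
    (λ γ ys ys≤ → ≤-trans (size-states (fun levels γ) ys)
      (*-mono-≤ (s≤s (s≤s (<⇒≤ (length<size {nat} (fun levels γ))))) (s≤s (+-monoˡ-≤ 6 ys≤))))
    (≲-* (≲-+ (≲-const 2) (size-fun levels)) (≲-suc (≲-+ (size-fun iss) (≲-const 6))))
    computing (λ γ → states (fun levels γ) (fun iss γ))
    by (λ γ → refl)
    where
    allExtended : ((Γ ⊗ list keyed) ⊗ list state) ⊗ nat ⇒ list state
    allExtended = concatMapF (mapF
      (binary add (var₁ then basic fst) (var₀ then basic fst) &
       binary add (var₁ then basic snd then basic fst) (var₀ then basic snd then basic fst) &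
       binary add (var₁ then basic snd then basic snd then basic fst) (var₀ then basic snd then basic snd then basic fst) &
       ((var₁ then basic snd then basic snd then basic snd) :: (var₀ then basic snd then basic snd then basic snd)))
      var₂) var₂

  -- Rounding the costs

  scale : ℕ → ℕ → ⟦ option ⟧ → ⟦ keyed ⟧
  scale N g (w , c , l) = w , apply div (c * N , g) , c , l

  weightOf costOf : List ⟦ option ⟧ → ℕ
  weightOf os = sum (map proj₁ os)
  costOf   os = sum (map (proj₁ ∘ proj₂) os)

  labelsOf : List ⟦ option ⟧ → List ⟦ Λ ⟧
  labelsOf = map (proj₂ ∘ proj₂)

  keyOf : ℕ → ℕ → List ⟦ option ⟧ → ℕ
  keyOf N g os = sum (map (λ o → proj₁ (proj₂ (scale N g o))) os)

  total-scale : ∀ N g os → total (map (scale N g) os) ≡ (weightOf os , keyOf N g os , costOf os , labelsOf os)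
  total-scale N g []       = refl
  total-scale N g (o ∷ os) = cong (extend (scale N g o)) (total-scale N g os)

  module _ (N g-1 : ℕ) where

    private
      g : ℕ
      g = suc g-1

    keyOf-lower : ∀ os → keyOf N g os * g ≤ costOf os * N
    keyOf-lower []                 = z≤n
    keyOf-lower ((w , c , l) ∷ os) = begin
      (c * N / g + keyOf N g os) * g        ≡⟨ *-distribʳ-+ g (c * N / g) _ ⟩
      c * N / g * g + keyOf N g os * g      ≤⟨ +-mono-≤ (m/n*n≤m (c * N) g) (keyOf-lower os) ⟩
      c * N + costOf os * N                 ≡⟨ *-distribʳ-+ N c _ ⟨
      (c + costOf os) * N                   ∎
      where open ≤-Reasoning

    -- Rounding down loses less than one unit per item, whence the summand `length os`.
    keyOf-upper : ∀ os → costOf os * N ≤ (keyOf N g os + length os) * g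
    keyOf-upper []                 = z≤n
    keyOf-upper ((w , c , l) ∷ os) = begin
      (c + costOf os) * N                                      ≡⟨ *-distribʳ-+ N c _ ⟩
      c * N + costOf os * N                                    ≤⟨ +-mono-≤ rounding (keyOf-upper os) ⟩
      (g + q * g) + (keyOf N g os + length os) * g             ≡⟨ solve 4 (λ g q k n → (g :+ q :* g) :+ (k :+ n) :* g := (q :+ k :+ (con 1 :+ n)) :* g) refl g q (keyOf N g os) (length os) ⟩
      (q + keyOf N g os + suc (length os)) * g                 ∎
      where
      open ≤-Reasoning
      open +-*-Solver
      q : ℕ
      q = c * N / g
      rounding : c * N ≤ g + q * g
      rounding = ≤-trans (≤-reflexive (m≡m%n+[m/n]*n (c * N) g)) (+-monoˡ-≤ _ (<⇒≤ (m%n<n (c * N) g)))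

    -- This keeps the table small: if no chosen cost exceeds the guess, each key is at most N, and
    -- levels up to the number of items times N suffice.
    keyOf-bound : ∀ os → (∀ {o} → o ∈ os → proj₁ (proj₂ o) ≤ g) → keyOf N g os ≤ length os * N
    keyOf-bound []                 _   = z≤n
    keyOf-bound ((w , c , l) ∷ os) c≤g = +-mono-≤
      (*-cancelʳ-≤ (c * N / g) N g (begin
        c * N / g * g  ≤⟨ m/n*n≤m (c * N) g ⟩
        c * N          ≤⟨ *-monoˡ-≤ N (c≤g (here refl)) ⟩
        g * N          ≡⟨ *-comm g N ⟩
        N * g          ∎))
      (keyOf-bound os (c≤g ∘ there))
      where open ≤-Reasoning

  cost≤costOf : ∀ {o os} → o ∈ os → proj₁ (proj₂ o) ≤ costOf os
  cost≤costOf (here refl) = m≤m+n _ _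
  cost≤costOf (there o∈)  = ≤-trans (cost≤costOf o∈) (m≤n+m _ _)

  -- Counts are kept as lists of `tt`, so that products of counts are again lists of controlled
  -- size. The additional element makes the count positive.
  units : {X : Set} → List X → List ⊤
  units xs = tt ∷ map (λ _ → tt) xs

  times : List ⊤ → List ⊤ → List ⊤
  times xs ys = concatMap (λ _ → map (λ _ → tt) ys) xs

  length-units : ∀ {X : Set} (xs : List X) → length (units xs) ≡ suc (length xs)
  length-units xs = cong suc (length-map _ xs)

  length-times : ∀ xs ys → length (times xs ys) ≡ length xs * length ys
  length-times xs ys = length-concatMap _ (length ys) xs (λ _ → length-map _ ys)

  module _ (ks : List ⊤) (iss : List (List ⟦ option ⟧)) where

    -- Its length is N = (n + 1) (k + 1) for n items and k units in `ks`: an error of n units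
    -- `g / N` is then less than `g / (k + 1)`.
    grid : List ⊤
    grid = times (units iss) (units ks)

    levels : List ℕ
    levels = indices (units (times (units iss) grid))

    -- The 1 is a positive guess that remains when all chosen options are free; it is the origin of
    -- the `1 ⊔` in the error term.
    guesses : List ℕ
    guesses = 1 ∷ concatMap (map (proj₁ ∘ proj₂)) iss

    -- A cost 0 among the guesses does no harm: `div` then gives every option key 0, and soundness
    -- does not depend on the keys.
    scaled : ℕ → List (List ⟦ keyed ⟧)
    scaled g = map (map (scale (length grid) g)) iss

    opaque
      solutions : ℕ → List (ℕ × List ⟦ Λ ⟧)
      solutions bound = concatMap
        (λ g → map (proj₂ ∘ proj₂) (filterLeq (λ s → proj₁ s , bound) (states levels (scaled g)))) guesses

    length-grid : length grid ≡ suc (length iss) * suc (length ks)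
    length-grid = trans (length-times (units iss) (units ks)) (cong₂ _*_ (length-units iss) (length-units ks))

    ∈-levels : ∀ q → q ≤ length iss * length grid → q ∈ levels
    ∈-levels q q≤ = ∈-indices⁺ {xs = units (times (units iss) grid)} (s≤s (begin
      q                                              ≤⟨ q≤ ⟩
      length iss * length grid                       ≤⟨ m≤n+m _ (length grid) ⟩
      suc (length iss) * length grid                 ≡⟨ cong (_* length grid) (length-units iss) ⟨
      length (units iss) * length grid               ≡⟨ length-times (units iss) grid ⟨
      length (times (units iss) grid)                ≡⟨ length-map _ (times (units iss) grid) ⟨
      length (map (λ _ → tt) (times (units iss) grid)) ∎))
      where open ≤-Reasoning

    opaque
      unfolding solutions

      solutions-sound : ∀ {bound c ls} → (c , ls) ∈ solutions bound →
                        ∃ λ os → Chosen os iss × weightOf os ≤ bound × c ≡ costOf os × ls ≡ labelsOf os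
      solutions-sound {bound} s∈ with find (∈-concatMap⁻ _ {xs = guesses} s∈)
      ... | g , _ , s∈g with ∈-map⁻ (proj₂ ∘ proj₂) s∈g
      ...   | s , s∈′ , eq with ∈-filterLeq⁻ (λ s → proj₁ s , bound) {xs = states levels (scaled g)} s∈′
      ...     | s∈″ , s≤bound with states-sound levels (scaled g) s∈″
      ...       | os , os∈ , refl with chosen-unmap (scale (length grid) g) iss os∈
      ...         | os′ , refl , os′∈ rewrite total-scale (length grid) g os′ =
        os′ , os′∈ , s≤bound , cong proj₁ eq , cong proj₂ eq

    -- For g the largest option cost up to the optimal value, the rounding
    -- loses at most g over all items together.
    rounding-loss : ∀ {g-1 os os′} → Chosen os iss → Chosen os′ iss →
      keyOf (length grid) (suc g-1) os′ ≤ keyOf (length grid) (suc g-1) os →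
      suc (length ks) * costOf os′ ≤ suc (length ks) * costOf os + suc g-1
    rounding-loss {g-1} {os} {os′} os∈ os′∈ key≤ = *-cancelˡ-≤ (suc n) (begin
      suc n * (K * costOf os′)                ≡⟨ solve 3 (λ n k c → n :* (k :* c) := c :* (n :* k)) refl (suc n) K (costOf os′) ⟩
      costOf os′ * (suc n * K)                ≡⟨ cong (costOf os′ *_) length-grid ⟨
      costOf os′ * N                          ≤⟨ keyOf-upper N g-1 os′ ⟩
      (keyOf N g os′ + length os′) * g        ≤⟨ *-monoˡ-≤ g (+-mono-≤ key≤ (≤-trans (≤-reflexive (chosen-length os′∈)) (n≤1+n n))) ⟩
      (keyOf N g os + suc n) * g              ≡⟨ *-distribʳ-+ g (keyOf N g os) (suc n) ⟩
      keyOf N g os * g + suc n * g            ≤⟨ +-monoˡ-≤ (suc n * g) (keyOf-lower N g-1 os) ⟩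
      costOf os * N + suc n * g               ≡⟨ cong (λ N → costOf os * N + suc n * g) length-grid ⟩
      costOf os * (suc n * K) + suc n * g     ≡⟨ solve 4 (λ n k c w → c :* (n :* k) :+ n :* w := n :* (k :* c :+ w)) refl (suc n) K (costOf os) g ⟩
      suc n * (K * costOf os + g)             ∎)
      where
      open ≤-Reasoning
      open +-*-Solver
      n K N g : ℕ
      n = length iss
      K = suc (length ks)
      N = length grid
      g = suc g-1

    opaque
      unfolding solutions

      -- Take as guess the largest candidate up to `1 ⊔ costOf os`. No chosen option costs more than
      -- the whole choice, so each costs at most the guess, and all keys lie within the levels. As
      -- the guess is at most `1 ⊔ costOf os`, the rounding loss becomes a relative error.
      solutions-complete : ∀ {bound os} → Chosen os iss → weightOf os ≤ bound →
        ∃ λ c → ∃ λ ls → (c , ls) ∈ solutions bound ×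
          suc (length ks) * c ≤ suc (length ks) * costOf os + (1 ⊔ costOf os)
      solutions-complete {bound} {os} os∈ os≤bound = guess (largest-below (concatMap (map (proj₁ ∘ proj₂)) iss) {1} {w} (m≤m⊔n 1 (costOf os)))
        where
        w N : ℕ
        w = 1 ⊔ costOf os
        N = length grid

        Goal : Set
        Goal = ∃ λ c → ∃ λ ls → (c , ls) ∈ solutions bound × suc (length ks) * c ≤ suc (length ks) * costOf os + w

        cost∈ : ∀ {o : ⟦ option ⟧} {os iss} → Chosen os iss → o ∈ os → Any (λ is → proj₁ (proj₂ o) ∈ map (proj₁ ∘ proj₂) is) iss
        cost∈ (o∈ ∷ _)  (here refl) = here (∈-map⁺ _ o∈)
        cost∈ (_ ∷ os∈) (there o∈)  = there (cost∈ os∈ o∈)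

        guess : (∃ λ g → g ∈ guesses × g ≤ w × (∀ {x} → x ∈ guesses → x ≤ w → x ≤ g)) → Goal
        -- The seed 1 is itself among the guesses, so the largest one is positive and the division
        -- by it is genuine.
        guess (zero    , _  , _   , below) with () ← below (here refl) (m≤m⊔n 1 (costOf os))
        guess (suc g-1 , g∈ , g≤w , below) = finish (states-complete {levels} {scaled g} level (chosen-map (scale N g) os∈))
          where
          g : ℕ
          g = suc g-1

          cost≤g : ∀ {o} → o ∈ os → proj₁ (proj₂ o) ≤ g
          cost≤g o∈ = below (there (∈-concatMap⁺ _ (cost∈ os∈ o∈))) (≤-trans (cost≤costOf o∈) (m≤n⊔m 1 _))

          level : ∀ q → q ≤ key (total (map (scale N g) os)) → q ∈ levels
          level q q≤ = ∈-levels q (≤-trans q≤ (subst₂ _≤_ (cong key (sym (total-scale N g os)))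
            (cong (_* N) (chosen-length os∈)) (keyOf-bound N g-1 os cost≤g)))

          finish : (∃ λ s → s ∈ states levels (scaled g) × key s ≤ key (total (map (scale N g) os)) ×
                            proj₁ s ≤ proj₁ (total (map (scale N g) os))) → Goal
          finish (s , s∈ , key≤ , weight≤) with states-sound levels (scaled g) s∈
          ... | kept , kept∈ , s≡ with chosen-unmap (scale N g) iss kept∈
          ...   | os′ , refl , os′∈ =
            proj₁ (proj₂ (proj₂ s)) , proj₂ (proj₂ (proj₂ s)) ,
            ∈-concatMap⁺ _ (lose g∈ (∈-map⁺ (proj₂ ∘ proj₂) (∈-filterLeq⁺ (λ s → proj₁ s , bound) s∈
              (≤-trans weight≤ (subst (_≤ bound) (cong proj₁ (sym (total-scale N g os))) os≤bound))))) ,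
            ≤-trans (≤-reflexive (cong (λ s → suc (length ks) * proj₁ (proj₂ (proj₂ s))) s≡total))
              (≤-trans (rounding-loss os∈ os′∈ (subst₂ _≤_ (cong key s≡total) (cong key (total-scale N g os)) key≤))
                (+-monoʳ-≤ (suc (length ks) * costOf os) g≤w))
            where
            s≡total : s ≡ (weightOf os′ , keyOf N g os′ , costOf os′ , labelsOf os′)
            s≡total = trans s≡ (total-scale N g os′)

  module _ (ks : Γ ⇒ list unit) (iss : Γ ⇒ list (list option)) (bound : Γ ⇒ nat) where

    unitsF : S ⇒ list A → S ⇒ list unit
    unitsF xs = basic drop :: mapF (basic drop) xs

    timesF : S ⇒ list unit → S ⇒ list unit → S ⇒ list unit
    timesF xs ys = concatMapF (mapF (basic drop) (weaken ys)) xs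

    gridF : Γ ⇒ list unit
    gridF = timesF (unitsF iss) (unitsF ks)
      computing (λ γ → grid (fun ks γ) (fun iss γ))
      by (λ γ → refl)

    levelsF : Γ ⇒ list nat
    levelsF = indicesF (unitsF (timesF (unitsF iss) gridF))
      computing (λ γ → levels (fun ks γ) (fun iss γ))
      by (λ γ → refl)

    guessesF : Γ ⇒ list nat
    guessesF = basic (lit 1) :: concatMapF (mapF (var₀ then basic snd then basic fst) var₀) iss

    scaledF : Γ ⊗ nat ⇒ list (list keyed)
    scaledF = mapF (mapF
      ((var₀ then basic fst) &
       binary div (binary mul (var₀ then basic snd then basic fst) (weaken (weaken (weaken (lengthF gridF))))) var₂ &
       (var₀ then basic snd))
      var₀) (weaken iss)
      computing (λ (γ , g) → scaled (fun ks γ) (fun iss γ) g)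
      by (λ γ → refl)

    allSolutionsF : Γ ⇒ list (nat ⊗ list Λ)
    allSolutionsF = concatMapF (mapF (var₀ then basic snd then basic snd)
      (filterLeqF ((var₀ then basic fst) & weaken (weaken bound)) (statesF (weaken levelsF) scaledF))) guessesF

    opaque
      unfolding solutions

      allSolutionsF≡solutions : ∀ γ → fun allSolutionsF γ ≡ solutions (fun ks γ) (fun iss γ) (fun bound γ)
      allSolutionsF≡solutions γ = refl

    solutionsF : Γ ⇒ list (nat ⊗ list Λ)
    solutionsF = allSolutionsF
      computing (λ γ → solutions (fun ks γ) (fun iss γ) (fun bound γ))
      by allSolutionsF≡solutions

-- The approximation algorithm

-- Applied to server loads, these are completion times: the server works through the jobs from the
-- last index to the first, the order in which a right fold accumulates.
suffixSums : List ℕ → ℕ × List ℕ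
suffixSums = foldr (λ p (s , out) → p + s , p + s ∷ out) (0 , [])

suffixSumsF : Γ ⇒ list nat → Γ ⇒ list nat
suffixSumsF {Γ} l = foldr′ (basic (lit 0) & basic nil) l
  (next & (next :: (var₀ then basic snd)))
  (λ γ → suc (bound γ + suc (bound γ) * suc (bound γ)))
  (λ γ ys ys≤ → s≤s (+-mono-≤ (≤-trans (size-sum ys) ys≤)
    (≤-trans (size-list≤ {nat} _ (λ s∈ → ≤-trans (size-mono (sums≤sum ys s∈)) (size-sum ys)))
      (*-mono-≤ (s≤s (≤-trans (≤-trans (≤-reflexive (length-sums ys)) (<⇒≤ (length<size {nat} ys))) ys≤)) (s≤s ys≤)))))
  (≲-suc (≲-+ (size-fun l) (≲-* (≲-suc (size-fun l)) (≲-suc (size-fun l)))))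
  then basic snd
  where
  next : (Γ ⊗ nat) ⊗ (nat ⊗ list nat) ⇒ nat
  next = binary add var₁ (var₀ then basic fst)

  bound : ⟦ Γ ⟧ → ℕ
  bound γ = size (list nat) (fun l γ)

  size-sum : ∀ ys → size nat (proj₁ (suffixSums ys)) ≤ size (list nat) ys
  size-sum []       = ≤-refl
  size-sum (y ∷ ys) = ≤-trans (size-+ y _) (≤-trans (+-monoʳ-≤ (size nat y) (size-sum ys)) (n≤1+n _))

  sums≤sum : ∀ ys {s} → s ∈ proj₂ (suffixSums ys) → s ≤ proj₁ (suffixSums ys)
  sums≤sum (y ∷ ys) (here refl) = ≤-refl
  sums≤sum (y ∷ ys) (there s∈)  = ≤-trans (sums≤sum ys s∈) (m≤n+m _ y)

  length-sums : ∀ ys → length (proj₂ (suffixSums ys)) ≡ length ys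
  length-sums []       = refl
  length-sums (y ∷ ys) = cong suc (length-sums ys)

place cloudInfo job : Ty
place   = unit ⊕ unit
-- cloud time, completion time and time at which the result is back
cloudInfo = unit ⊕ nat ⊗ nat ⊗ nat
job       = nat ⊗ nat ⊗ cloudInfo

-- `inj₁` marks a job that cannot be offloaded; the infinite cloud times of source and sink thus
-- keep both on the server.
offload : ⟦ extended ⟧ → ⟦ extended ⟧ → ⟦ extended ⟧ → ⟦ cloudInfo ⟧
offload p x y = case p (λ _ → inj₁ tt) λ p → case x (λ _ → inj₁ tt) λ x → case y (λ _ → inj₁ tt) λ y →
  inj₂ (p , x + p , (x + p) + y)

offloadF : Γ ⇒ extended → Γ ⇒ extended → Γ ⇒ extended → Γ ⇒ cloudInfo
offloadF p x y =
  caseOf p (basic drop then basic inl)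
    (caseOf (weaken x) (basic drop then basic inl)
      (caseOf (weaken (weaken y)) (basic drop then basic inl)
        ((var₂ & binary add var₁ var₂ & binary add (binary add var₁ var₂) var₀) then basic inr)))

-- Reads the source row and the sink column of the delay matrix, which in a fully parallel graph
-- contain every edge.
jobList : ⟦ graph ⟧ → List ⟦ job ⟧
jobList (source , sink , ps , cs , delays) =
  map (λ (i , p , c , x , y) → i , p , offload c x y)
    (zipEnds (indices ps) (zipEnds ps (zipEnds cs
      (zipEnds (nth [] source delays) (map (nth (inj₁ tt) sink) delays)))))

sourceF sinkF : Γ ⇒ graph → Γ ⇒ nat
sourceF g = g then basic fst
sinkF   g = g then basic snd then basic fst

jobListF : Γ ⇒ graph → Γ ⇒ list job
jobListF {Γ} g =
  mapF ((var₀ then basic fst) & (var₀ then basic snd then basic fst) &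
        offloadF (var₀ then basic snd then basic snd then basic fst)
                 (var₀ then basic snd then basic snd then basic snd then basic fst)
                 (var₀ then basic snd then basic snd then basic snd then basic snd))
    (zipF (indicesF ps) (zipF ps (zipF cs
      (zipF (nthF (basic nil) (sourceF g) delays)
            (mapF (nthF (basic drop then basic inl) (weaken (sinkF g)) var₀) delays)))))
  computing (λ γ → jobList (fun g γ))
  by (λ γ → refl)
  where
  ps : Γ ⇒ list nat
  ps = g then basic snd then basic snd then basic fst
  cs : Γ ⇒ list extended
  cs = g then basic snd then basic snd then basic snd then basic fst
  delays : Γ ⇒ list (list extended)
  delays = g then basic snd then basic snd then basic snd then basic snd

load : ⟦ job ⊗ place ⟧ → ℕ
load ((_ , p , _) , l) = case l (λ _ → p) (λ _ → 0)

-- Inner server jobs run without gaps from time 0, a cloud job starts when its data arrives, and the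
-- sink waits until `M`. The last 0 is a filler: a job without cloud data has no cloud option.
completionTime : ℕ → ℕ → ℕ → ℕ → ⟦ job ⊗ place ⟧ → ℕ
completionTime source sink M s ((i , _ , c) , l) =
  if≡ i source 0 (if≡ i sink M (case l (λ _ → s) (λ _ → case c (λ _ → 0) (λ (_ , a , _) → a))))

assemble : ℕ → ℕ → ℕ → List ⟦ job ⟧ → List ⟦ place ⟧ → ⟦ schedule ⟧
assemble source sink M js ls =
  map (λ (s , j , l) → l , completionTime source sink M s (j , l))
    (zipEnds (proj₂ (suffixSums (map load (zipEnds js ls)))) (zipEnds js ls))

assembleF : Γ ⇒ nat → Γ ⇒ nat → Γ ⇒ nat → Γ ⇒ list job → Γ ⇒ list place → Γ ⇒ schedule
assembleF source sink M js ls =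
  mapF ((var₀ then basic snd then basic snd) &
        ifEq (var₀ then basic snd then basic fst then basic fst) (weaken source) (basic (lit 0))
          (ifEq (var₀ then basic snd then basic fst then basic fst) (weaken sink) (weaken M)
            (caseOf (var₀ then basic snd then basic snd) (var₁ then basic fst)
              (caseOf (var₁ then basic snd then basic fst then basic snd then basic snd) (basic (lit 0))
                (var₀ then basic snd then basic fst)))))
    (zipF (suffixSumsF (mapF (caseOf (var₀ then basic snd) (var₁ then basic fst then basic snd then basic fst) (basic (lit 0)))
                             (zipF js ls)))
          (zipF js ls))
  computing (λ γ → assemble (fun source γ) (fun sink γ) (fun M γ) (fun js γ) (fun ls γ))
  by (λ γ → refl)

open Knapsack place

data Objective : Set where
  min-cost min-makespan : Objective

-- The objective charges the machine that the bound does not.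
orient : Objective → ℕ × ℕ → ⟦ place ⟧ → ⟦ option ⟧
orient min-cost     (onServer , onCloud) l = onServer , onCloud , l
orient min-makespan (onServer , onCloud) l = onCloud , onServer , l

orientF : Objective → Γ ⇒ nat ⊗ nat → Γ ⇒ place → Γ ⇒ option
orientF {Γ} obj p l = oriented obj computing (λ γ → orient obj (fun p γ) (fun l γ)) by agree obj
  where
  oriented : Objective → Γ ⇒ option
  oriented min-cost     = (p then basic fst) & (p then basic snd) & l
  oriented min-makespan = (p then basic snd) & (p then basic fst) & l
  agree : ∀ obj γ → fun (oriented obj) γ ≡ orient obj (fun p γ) (fun l γ)
  agree min-cost     γ = refl
  agree min-makespan γ = refl

options : Objective → ℕ → ⟦ job ⟧ → List ⟦ option ⟧
options obj L (_ , p , c) = orient obj (p , 0) (inj₁ tt) ∷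
  case c (λ _ → []) (λ (q , _ , back) → if≤ (back , L) (orient obj (0 , q) (inj₂ tt) ∷ []) [])

optionsF : Objective → Γ ⇒ nat → Γ ⇒ job → Γ ⇒ list option
optionsF obj L j = orientF obj ((j then basic snd then basic fst) & basic (lit 0)) (basic drop then basic inl) ::
  caseOf (j then basic snd then basic snd) (basic nil)
    (ifLeq ((var₀ then basic snd then basic snd) & weaken L)
      (orientF obj (basic (lit 0) & (var₀ then basic fst)) (basic drop then basic inr) :: basic nil)
      (basic nil))

backTime : ⟦ job ⟧ → List ℕ
backTime (_ , _ , c) = case c (λ _ → []) (λ (_ , _ , back) → back ∷ [])

-- Every schedule offloads exactly jobs that can be back by some
-- threshold, so it suffices to try the following ones.
thresholds : Objective → ℕ → List ⟦ job ⟧ → List ℕ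
thresholds min-cost     bound js = bound ∷ []
thresholds min-makespan bound js = 0 ∷ concatMap backTime js

thresholdsF : Objective → Γ ⇒ nat → Γ ⇒ list job → Γ ⇒ list nat
thresholdsF {Γ} obj bound js = tried obj computing (λ γ → thresholds obj (fun bound γ) (fun js γ)) by agree obj
  where
  tried : Objective → Γ ⇒ list nat
  tried min-cost     = bound :: basic nil
  tried min-makespan = basic (lit 0) ::
    concatMapF (caseOf (var₀ then basic snd then basic snd) (basic nil) ((var₀ then basic snd then basic snd) :: basic nil)) js
  agree : ∀ obj γ → fun (tried obj) γ ≡ thresholds obj (fun bound γ) (fun js γ)
  agree min-cost     γ = refl
  agree min-makespan γ = refl

-- The objective value and the makespan of a solution
evaluate : Objective → ℕ → ℕ × List ⟦ place ⟧ → ℕ × ℕ × List ⟦ place ⟧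
evaluate min-cost     L (c , ls) = c , L , ls
evaluate min-makespan L (c , ls) = c + (L ∸ c) , c + (L ∸ c) , ls

evaluateF : Objective → Γ ⇒ nat → Γ ⇒ nat ⊗ list place → Γ ⇒ nat ⊗ nat ⊗ list place
evaluateF {Γ} obj L s = evaluated obj computing (λ γ → evaluate obj (fun L γ) (fun s γ)) by agree obj
  where
  later : Γ ⇒ nat
  -- The maximum of load and threshold, expressed by truncated subtraction and addition.
  later = binary add (s then basic fst) (binary sub L (s then basic fst))
  evaluated : Objective → Γ ⇒ nat ⊗ nat ⊗ list place
  evaluated min-cost     = (s then basic fst) & L & (s then basic snd)
  evaluated min-makespan = later & later & (s then basic snd)
  agree : ∀ obj γ → fun (evaluated obj) γ ≡ evaluate obj (fun L γ) (fun s γ)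
  agree min-cost     γ = refl
  agree min-makespan γ = refl

candidatesAt : Objective → List ⊤ → List ⟦ job ⟧ → ℕ → ℕ → List (ℕ × ℕ × List ⟦ place ⟧)
candidatesAt obj ks js bound L = map (evaluate obj L) (solutions ks (map (options obj L) js) bound)

candidates : Objective → List ⊤ → List ⟦ job ⟧ → ℕ → List (ℕ × ℕ × List ⟦ place ⟧)
candidates obj ks js bound = concatMap (candidatesAt obj ks js bound) (thresholds obj bound js)

algorithm : Objective → List ⊤ → ⟦ graph ⟧ → ℕ → ⟦ unit ⊕ schedule ⟧
algorithm obj ks g bound = case (minBy (candidates obj ks (jobList g) bound)) (λ _ → inj₁ tt)
  (λ (_ , M , ls) → inj₂ (assemble (proj₁ g) (proj₁ (proj₂ g)) M (jobList g) ls))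

algorithmF : Objective → list unit ⊗ graph ⊗ nat ⇒ unit ⊕ schedule
algorithmF obj =
  caseOf (minByF candidatesF) (basic drop then basic inl)
    (assembleF (weaken (sourceF g)) (weaken (sinkF g)) (var₀ then basic snd then basic fst) (weaken (jobListF g))
       (var₀ then basic snd then basic snd) then basic inr)
  computing (λ (ks , g , bound) → algorithm obj ks g bound)
  by (λ γ → refl)
  where
  Input : Ty
  Input = list unit ⊗ graph ⊗ nat
  g : Input ⇒ graph
  g = basic snd then basic fst
  bound : Input ⇒ nat
  bound = basic snd then basic snd
  candidatesF : Input ⇒ list (nat ⊗ nat ⊗ list place)
  candidatesF =
    concatMapF (mapF (evaluateF obj var₁ var₀)
      (solutionsF (weaken (basic fst)) (mapF (optionsF obj var₁ var₀) (weaken (jobListF g))) (weaken bound)))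
      (thresholdsF obj bound (jobListF g))
    computing (λ (ks , g , bound) → candidates obj ks (jobList g) bound)
      by (λ γ → refl)

-- Sums over finite index sets

Σ[_] : ∀ {n} → (Fin n → ℕ) → ℕ
Σ[ f ] = sum (tabulate f)

Σ-mono : ∀ {n} {f g : Fin n → ℕ} → (∀ i → f i ≤ g i) → Σ[ f ] ≤ Σ[ g ]
Σ-mono {zero}  f≤g = z≤n
Σ-mono {suc n} f≤g = +-mono-≤ (f≤g zero) (Σ-mono (f≤g ∘ suc))

-- Among any two summands one does not grow, so the total increase comes from a single summand. This
-- is the effect of advancing the time horizon by one slot.
Σ-increment : ∀ {n} {f g : Fin n → ℕ} → (∀ i → g i ≤ suc (f i)) →
              (∀ i j → i ≢ j → g i ≤ f i ⊎ g j ≤ f j) → Σ[ g ] ≤ suc Σ[ f ]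
Σ-increment {zero}  g≤1+f once = z≤n
Σ-increment {suc n} {f} {g} g≤1+f once with g zero ≤? f zero
... | yes g≤f = ≤-trans (+-mono-≤ g≤f (Σ-increment (g≤1+f ∘ suc) (λ i j i≢j → once (suc i) (suc j) (i≢j ∘ Finₚ.suc-injective))))
                        (≤-reflexive (+-suc (f zero) _))
... | no  g≰f = +-mono-≤ (g≤1+f zero) (Σ-mono rest)
  where
  rest : ∀ i → g (suc i) ≤ f (suc i)
  rest i with once zero (suc i) (λ ())
  ... | inj₁ g≤f = contradiction g≤f g≰f
  ... | inj₂ g≤f = g≤f

-- Each unit time slot meets at most one of the disjoint intervals [S i , C i).
Σ-disjoint : ∀ {n} (S C : Fin n → ℕ) →
             (∀ i j → i ≢ j → S i < C i → S j < C j → C i ≤ S j ⊎ C j ≤ S i) →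
             ∀ M → Σ[ (λ i → (M ⊓ C i) ∸ S i) ] ≤ M
Σ-disjoint {n} S C disjoint zero    = ≤-trans (Σ-mono (λ i → ≤-reflexive (0∸n≡0 (S i)))) (≤-reflexive (Σ-zero n))
  where
  Σ-zero : ∀ n → Σ[ (λ (i : Fin n) → 0) ] ≡ 0
  Σ-zero zero    = refl
  Σ-zero (suc n) = Σ-zero n
Σ-disjoint {n} S C disjoint (suc M) = ≤-trans (Σ-increment grows once) (s≤s (Σ-disjoint S C disjoint M))
  where
  before after : Fin n → ℕ
  before i = (M ⊓ C i) ∸ S i
  after  i = (suc M ⊓ C i) ∸ S i

  grows : ∀ i → after i ≤ suc (before i)
  grows i = ≤-trans (∸-monoˡ-≤ (S i) (⊓-monoʳ-≤ (suc M) (n≤1+n (C i)))) (m+n∸o≤m+[n∸o] 1 (M ⊓ C i) (S i))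
    where
    m+n∸o≤m+[n∸o] : ∀ m n o → (m + n) ∸ o ≤ m + (n ∸ o)
    m+n∸o≤m+[n∸o] m n o = m≤n+o⇒m∸n≤o (m + n) o (begin
      m + n              ≤⟨ +-monoʳ-≤ m (m≤n+m∸n n o) ⟩
      m + (o + (n ∸ o))  ≡⟨ +-assoc m o (n ∸ o) ⟨
      m + o + (n ∸ o)    ≡⟨ cong (_+ (n ∸ o)) (+-comm m o) ⟩
      o + m + (n ∸ o)    ≡⟨ +-assoc o m (n ∸ o) ⟩
      o + (m + (n ∸ o))  ∎)
      where open ≤-Reasoning

  idle⊎busy : ∀ i → after i ≤ before i ⊎ (S i ≤ M × M < C i)
  idle⊎busy i with C i ≤? M | S i ≤? M
  ... | yes C≤M | _       = inj₁ (≤-reflexive (cong (_∸ S i) (trans (m≥n⇒m⊓n≡n (m≤n⇒m≤1+n C≤M)) (sym (m≥n⇒m⊓n≡n C≤M)))))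
  ... | no  _   | no  S≰M = inj₁ (≤-trans (≤-reflexive (m≤n⇒m∸n≡0 (≤-trans (m⊓n≤m (suc M) (C i)) (≰⇒> S≰M)))) z≤n)
  ... | no  C≰M | yes S≤M = inj₂ (S≤M , ≰⇒> C≰M)

  once : ∀ i j → i ≢ j → after i ≤ before i ⊎ after j ≤ before j
  once i j i≢j with idle⊎busy i | idle⊎busy j
  ... | inj₁ idle        | _                = inj₁ idle
  ... | _                | inj₁ idle        = inj₂ idle
  ... | inj₂ (Si≤M , M<Ci) | inj₂ (Sj≤M , M<Cj)
    with disjoint i j i≢j (≤-<-trans Si≤M M<Ci) (≤-<-trans Sj≤M M<Cj)
  ...   | inj₁ Ci≤Sj = contradiction (<-≤-trans M<Ci (≤-trans Ci≤Sj Sj≤M)) (<-irrefl refl)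
  ...   | inj₂ Cj≤Si = contradiction (<-≤-trans M<Cj (≤-trans Cj≤Si Si≤M)) (<-irrefl refl)

suffixAt : ∀ {n} → (Fin n → ℕ) → Fin n → ℕ
suffixAt f zero    = Σ[ f ]
suffixAt f (suc i) = suffixAt (f ∘ suc) i

suffixSums-tabulate : ∀ {n} (f : Fin n → ℕ) → suffixSums (tabulate f) ≡ (Σ[ f ] , tabulate (suffixAt f))
suffixSums-tabulate {zero}  f = refl
suffixSums-tabulate {suc n} f = cong (λ (s , out) → f zero + s , f zero + s ∷ out) (suffixSums-tabulate (f ∘ suc))

≤-suffixAt : ∀ {n} (f : Fin n → ℕ) i → f i ≤ suffixAt f i
≤-suffixAt f zero    = m≤m+n _ _
≤-suffixAt f (suc i) = ≤-suffixAt (f ∘ suc) i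

suffixAt-≤ : ∀ {n} (f : Fin n → ℕ) i → suffixAt f i ≤ Σ[ f ]
suffixAt-≤ f zero    = ≤-refl
suffixAt-≤ f (suc i) = ≤-trans (suffixAt-≤ (f ∘ suc) i) (m≤n+m _ (f zero))

-- Read with completion times, this makes the server run sequential: a job starts only after the
-- jobs of higher index have ended.
suffixAt-< : ∀ {n} (f : Fin n → ℕ) {i j} → i Fin.< j → suffixAt f j + f i ≤ suffixAt f i
suffixAt-< f {zero}  {suc j} _         = ≤-trans (≤-reflexive (+-comm _ (f zero))) (+-monoʳ-≤ (f zero) (suffixAt-≤ (f ∘ suc) j))
suffixAt-< f {suc i} {suc j} (s≤s i<j) = suffixAt-< (f ∘ suc) i<j

chosen-tabulate : ∀ {X : Set} {n os} (item : Fin n → List X) → Chosen os (tabulate item) →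
                  ∃ λ (o : Fin n → X) → os ≡ tabulate o × (∀ i → o i ∈ item i)
chosen-tabulate {n = zero}  item []         = (λ ()) , refl , (λ ())
chosen-tabulate {n = suc n} item (_∷_ {x = x} o∈ os∈) with chosen-tabulate (item ∘ suc) os∈
... | o , refl , all∈ = (λ { zero → x ; (suc i) → o i }) , refl , (λ { zero → o∈ ; (suc i) → all∈ i })

finite : ℕ∞ → ℕ
finite = fromMaybe 0

Σ∞-finite⁻ : ∀ {n} (f : Fin n → ℕ∞) {v} → Vec.foldr _+∞_ (just 0) f ≡ just v →
             (∀ i → f i ≡ just (finite (f i))) × v ≡ Σ[ finite ∘ f ]
Σ∞-finite⁻ {zero}  f refl = (λ ()) , refl
Σ∞-finite⁻ {suc n} f eq with f zero in f₀ | Vec.foldr _+∞_ (just 0) (f ∘ suc) in rest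
Σ∞-finite⁻ {suc n} f refl | just x | just y with Σ∞-finite⁻ (f ∘ suc) rest
... | finite-rest , y≡ = (λ { zero → trans f₀ (cong (just ∘ finite) (sym f₀)) ; (suc i) → finite-rest i }) ,
                         cong (x +_) y≡

Σ∞-finite⁺ : ∀ {n} (f : Fin n → ℕ∞) (g : Fin n → ℕ) → (∀ i → f i ≡ just (g i)) → Vec.foldr _+∞_ (just 0) f ≡ just Σ[ g ]
Σ∞-finite⁺ {zero}  f g f≡g = refl
Σ∞-finite⁺ {suc n} f g f≡g = cong₂ _+∞_ (f≡g zero) (Σ∞-finite⁺ (f ∘ suc) (g ∘ suc) (f≡g ∘ suc))

-- Fully parallel task graphs

module FullyParallelGraph (G : TaskGraph) (parallel : FullyParallel G) where
  open TaskGraph G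

  Inner : Job → Set
  Inner j = j ≢ source × j ≢ sink

  is-just : ∀ {m : ℕ∞} → Is-just m → ∃ λ c → m ≡ just c
  is-just (Maybe.just _) = _ , refl

  just-is : ∀ {m : ℕ∞} {c} → m ≡ just c → Is-just m
  just-is refl = Maybe.just tt

  no-edge-to-source : ∀ {u} → ¬ Edge u source
  no-edge-to-source {u} = Equivalence.from (source-unique source) refl u

  no-edge-from-sink : ∀ {v} → ¬ Edge sink v
  no-edge-from-sink {v} = Equivalence.from (sink-unique sink) refl v

  edge-from-source : ∀ {j} → Inner j → Edge source j
  edge-from-source {j} (j≢s , j≢t) = proj₁ (Equivalence.from (parallel j j≢s j≢t source j) (inj₁ (refl , refl)))

  edge-to-sink : ∀ {j} → Inner j → Edge j sink
  edge-to-sink {j} (j≢s , j≢t) = proj₁ (Equivalence.from (parallel j j≢s j≢t j sink) (inj₂ (refl , refl)))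

  -- `FullyParallel` restricts only edges at inner jobs, so a direct edge from source to sink
  -- remains possible.
  data EdgeView : Job → Job → Set where
    fork   : ∀ {j} → Inner j → EdgeView source j
    join   : ∀ {j} → Inner j → sink ≢ source → EdgeView j sink
    bypass : EdgeView source sink

  edgeView : ∀ u v → Edge u v → EdgeView u v
  edgeView u v e with u Finₚ.≟ source | v Finₚ.≟ sink
  ... | yes refl | yes refl = bypass
  ... | yes refl | no  v≢t  = fork ((λ { refl → no-edge-to-source e }) , v≢t)
  ... | no  u≢s  | v≟t
    with Equivalence.to (parallel u u≢s (λ { refl → no-edge-from-sink e }) u v) (e , inj₁ refl)
  ...   | inj₁ (u≡s , _)  = contradiction u≡s u≢s
  ...   | inj₂ (_ , refl) = join (u≢s , λ { refl → no-edge-from-sink e }) (λ t≡s → no-edge-to-source (subst (Edge u) t≡s e))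

  finite⇒inner : ∀ {j c} → cloudTime j ≡ just c → Inner j
  finite⇒inner {j} eq = (λ j≡s → absurd (inj₁ j≡s)) , (λ j≡t → absurd (inj₂ j≡t))
    where
    absurd : ¬ (j ≡ source ⊎ j ≡ sink)
    absurd endpoint with () ← trans (sym eq) (Equivalence.from (cloudTime-∞ j) endpoint)

  onServer onCloud : Side → Job → ℕ
  onServer server j = serverTime j
  onServer cloud  j = 0
  onCloud server j = 0
  onCloud cloud  j = finite (cloudTime j)

  record Offloadable (L : ℕ) (j : Job) : Set where
    constructor offloadable
    field
      {out-delay back-delay work} : ℕ
      cloudTime≡ : cloudTime j ≡ just work
      out≡     : delay source j ≡ just out-delay
      back≡      : delay j sink ≡ just back-delay
      in-time    : (out-delay + work) + back-delay ≤ L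

  open Offloadable

  -- A condition on each job separately, because offloaded jobs never compete for a machine.
  Affordable : ℕ → (Job → Side) → Set
  Affordable L side = ∀ j → side j ≡ cloud → Offloadable L j

  serverLoad cloudLoad : (Job → Side) → ℕ
  serverLoad side = Σ[ (λ j → onServer (side j) j) ]
  cloudLoad  side = Σ[ (λ j → onCloud (side j) j) ]

  -- What a valid schedule of finite cost must satisfy

  module _ (σ : Schedule G) where
    open Schedule σ

    procTime-server : ∀ {j} → side j ≡ server → procTime σ j ≡ just (serverTime j)
    procTime-server {j} eq with server ← side j = refl

    procTime-cloud : ∀ {j c} → side j ≡ cloud → cloudTime j ≡ just c → procTime σ j ≡ just c
    procTime-cloud {j} eq c≡ with cloud ← side j = c≡

    start⁻ : ∀ {x j p} → procTime σ j ≡ just p → _≤start_ σ x j → x + p ≤ completion j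
    start⁻ {x} {j} p≡ x≤ = [≤]-injective (subst (λ m → just x +∞ m ≤∞ just (completion j)) p≡ x≤)

    start⁺ : ∀ {x j p} → procTime σ j ≡ just p → x + p ≤ completion j → _≤start_ σ x j
    start⁺ {x} {j} p≡ x≤ = subst (λ m → just x +∞ m ≤∞ just (completion j)) (sym p≡) [ x≤ ]

    cloudCost-onCloud : (∀ j → side j ≡ cloud → ∃ λ c → cloudTime j ≡ just c) →
                        ∀ j → cloudCost σ j ≡ just (onCloud (side j) j)
    cloudCost-onCloud finite-cloud j with side j | finite-cloud j
    ... | server | _ = refl
    ... | cloud  | f with f refl
    ...   | c , c≡ = trans c≡ (cong (just ∘ finite) (sym c≡))

    cloudCost-finite : ∀ {j c} → cloudCost σ j ≡ just c → side j ≡ cloud → cloudTime j ≡ just c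
    cloudCost-finite {j} c≡ eq with cloud ← side j = c≡

    module _ {v} (cost≡ : totalCost σ ≡ just v) where

      cloud-finite : ∀ j → side j ≡ cloud → ∃ λ c → cloudTime j ≡ just c
      cloud-finite j j-cloud = _ , cloudCost-finite (proj₁ (Σ∞-finite⁻ (cloudCost σ) cost≡) j) j-cloud

      cost≡cloudLoad : v ≡ cloudLoad side
      cost≡cloudLoad = trans (proj₂ (Σ∞-finite⁻ (cloudCost σ) cost≡))
        (cong sum (tabulate-cong (cong finite ∘ cloudCost-onCloud cloud-finite)))

      -- An endpoint in the cloud would contribute ∞ to the total cost.
      on-server : ∀ {j} → ¬ Inner j → side j ≡ server
      on-server {j} endpoint with side j in eq
      ... | server = refl
      ... | cloud  = contradiction (finite⇒inner (proj₂ (cloud-finite j eq))) endpoint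

      source-server : side source ≡ server
      source-server = on-server (λ (s≢s , _) → s≢s refl)

      sink-server : side sink ≡ server
      sink-server = on-server (λ (_ , t≢t) → t≢t refl)

      module _ (valid : Valid σ) where
        open Valid valid

        -- Follow the path from the source over `j` to the sink: both edges change sides, so both
        -- delays are paid.
        offloaded-in-time : Affordable (makespan σ) side
        offloaded-in-time j j-cloud
          with cloud-finite j j-cloud
        ... | c , c≡ with is-just (edge-from-source (finite⇒inner c≡)) | is-just (edge-to-sink (finite⇒inner c≡))
        ...   | x , x≡ | y , y≡ = offloadable c≡ x≡ y≡ (begin
          x + c + y                          ≤⟨ +-monoˡ-≤ y (+-monoˡ-≤ c (m≤n+m x (completion source))) ⟩
          completion source + x + c + y      ≤⟨ +-monoˡ-≤ y (start⁻ (procTime-cloud j-cloud c≡)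
                                                  (transfer source j x x≡ (different source-server j-cloud))) ⟩
          completion j + y                   ≤⟨ m≤m+n _ _ ⟩
          completion j + y + serverTime sink ≤⟨ start⁻ (procTime-server sink-server)
                                                  (transfer j sink y y≡ (different sink-server j-cloud ∘ sym)) ⟩
          completion sink                    ∎)
          where
          open ≤-Reasoning
          different : ∀ {i j} → side i ≡ server → side j ≡ cloud → side i ≢ side j
          different si sj eq with () ← trans (sym si) (trans eq sj)

        private
          p : Job → ℕ
          p j = onServer (side j) j

          start : Job → ℕ
          start j = completion j ∸ p j

        -- The edges from the source and to the sink confine an inner server job to the time from 0
        -- to the makespan, so neither the truncated subtraction nor the minimum shortens its
        -- interval. In the other cases the processing time is 0.
        p≤span : ∀ j → p j ≤ (makespan σ ⊓ completion j) ∸ start j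
        p≤span j with side j in eq
        ... | cloud  = z≤n
        ... | server with j Finₚ.≟ source | j Finₚ.≟ sink
        ...   | yes refl | _        = ≤-trans (≤-reflexive serverTime-source) z≤n
        ...   | no _     | yes refl = ≤-trans (≤-reflexive serverTime-sink) z≤n
        ...   | no j≢s   | no j≢t   = ≤-reflexive (sym (begin
          (makespan σ ⊓ completion j) ∸ (completion j ∸ serverTime j)
            ≡⟨ cong (_∸ (completion j ∸ serverTime j)) (m≥n⇒m⊓n≡n before-sink) ⟩
          completion j ∸ (completion j ∸ serverTime j)
            ≡⟨ m∸[m∸n]≡n after-source ⟩
          serverTime j ∎))
          where
          open ≡-Reasoning
          before-sink : completion j ≤ makespan σ
          before-sink = ≤-trans (m≤m+n _ (serverTime sink)) (start⁻ (procTime-server sink-server)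
            (precedence j sink (edge-to-sink (j≢s , j≢t)) (trans eq (sym sink-server))))
          after-source : serverTime j ≤ completion j
          after-source = ≤-trans (m≤n+m _ (completion source)) (start⁻ (procTime-server eq)
            (precedence source j (edge-from-source (j≢s , j≢t)) (trans source-server (sym eq))))

        serverLoad≤makespan : serverLoad side ≤ makespan σ
        serverLoad≤makespan = ≤-trans (Σ-mono p≤span) (Σ-disjoint start completion disjoint (makespan σ))
          where
          -- Cloud jobs have load 0 and hence an empty interval, so disjointness has to be checked
          -- on the server only.
          busy⇒server : ∀ {j} → start j < completion j → side j ≡ server
          busy⇒server {j} busy with side j
          ... | server = refl
          ... | cloud  = contradiction busy (<-irrefl refl)
          later : ∀ {i j} → side j ≡ server → _≤start_ σ (completion i) j → completion i ≤ start j
          later {i} {j} eq i≤j = m+n≤o⇒m≤o∸n (completion i)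
            (subst (λ s → completion i + onServer s j ≤ completion j) (sym eq) (start⁻ (procTime-server eq) i≤j))
          disjoint : ∀ i j → i ≢ j → start i < completion i → start j < completion j →
                     completion i ≤ start j ⊎ completion j ≤ start i
          disjoint i j i≢j bi bj with machine i j i≢j (busy⇒server bi) (busy⇒server bj)
          ... | inj₁ i≤j = inj₁ (later (busy⇒server bj) i≤j)
          ... | inj₂ j≤i = inj₂ (later (busy⇒server bi) j≤i)

  -- Reading the jobs from the encoded graph

  jobOf : Job → ⟦ job ⟧
  jobOf j = toℕ j , serverTime j ,
    offload (encodeExtended (cloudTime j)) (encodeExtended (delay source j)) (encodeExtended (delay j sink))

  jobList-encodeGraph : jobList (encodeGraph G) ≡ tabulate jobOf
  jobList-encodeGraph = begin
    jobList (encodeGraph G)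
      ≡⟨ cong₂ (λ out back → map toJob (zipEnds (indices ps) (zipEnds ps (zipEnds cs (zipEnds out back)))))
           (nth-tabulate [] row source)
           (trans (map-tabulate row (nth (inj₁ tt) (toℕ sink))) (tabulate-cong λ i → nth-tabulate (inj₁ tt) (encodeExtended ∘ delay i) sink)) ⟩
    map toJob (zipEnds (indices ps) (zipEnds ps (zipEnds cs (zipEnds (tabulate out) (tabulate back)))))
      ≡⟨ cong (λ z → map toJob (zipEnds (indices ps) (zipEnds ps (zipEnds cs z)))) (zipEnds-tabulate out back) ⟩
    map toJob (zipEnds (indices ps) (zipEnds ps (zipEnds cs (tabulate (λ j → out j , back j)))))
      ≡⟨ cong (λ z → map toJob (zipEnds (indices ps) (zipEnds ps z))) (zipEnds-tabulate cloud-times (λ j → out j , back j)) ⟩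
    map toJob (zipEnds (indices ps) (zipEnds ps (tabulate (λ j → cloud-times j , out j , back j))))
      ≡⟨ cong₂ (λ is z → map toJob (zipEnds is z)) (indices-tabulate serverTime) (zipEnds-tabulate serverTime (λ j → cloud-times j , out j , back j)) ⟩
    map toJob (zipEnds (tabulate index) (tabulate (λ j → serverTime j , cloud-times j , out j , back j)))
      ≡⟨ cong (map toJob) (zipEnds-tabulate index (λ j → serverTime j , cloud-times j , out j , back j)) ⟩
    map toJob (tabulate (λ j → index j , serverTime j , cloud-times j , out j , back j))
      ≡⟨ map-tabulate (λ j → index j , serverTime j , cloud-times j , out j , back j) toJob ⟩
    tabulate jobOf ∎
    where
    open ≡-Reasoning
    toJob : ℕ × ℕ × ⟦ extended ⟧ × ⟦ extended ⟧ × ⟦ extended ⟧ → ⟦ job ⟧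
    toJob (i , p , c , x , y) = i , p , offload c x y
    index : Job → ℕ
    index = toℕ
    row : Job → List ⟦ extended ⟧
    row i = tabulate (encodeExtended ∘ delay i)
    cloud-times out back : Job → ⟦ extended ⟧
    cloud-times = encodeExtended ∘ cloudTime
    out j = encodeExtended (delay source j)
    back  j = encodeExtended (delay j sink)
    ps : List ℕ
    ps = tabulate serverTime
    cs : List ⟦ extended ⟧
    cs = tabulate cloud-times

  -- The schedule built from an assignment of sides

  module _ (side : Job → Side) (M : ℕ) where

    loads : Job → ℕ
    loads j = onServer (side j) j

    build : Schedule G
    build = record
      { side       = side
      ; completion = λ j → completionTime (toℕ source) (toℕ sink) M (suffixAt loads j) (jobOf j , encodeSide (side j))
      }

    open Schedule build using (completion)

    assemble-build : assemble (toℕ source) (toℕ sink) M (tabulate jobOf) (tabulate (encodeSide ∘ side)) ≡ encodeSchedule build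
    assemble-build = begin
      map place-at (zipEnds (proj₂ (suffixSums (map load (zipEnds (tabulate jobOf) (tabulate (encodeSide ∘ side))))))
                            (zipEnds (tabulate jobOf) (tabulate (encodeSide ∘ side))))
        ≡⟨ cong (λ z → map place-at (zipEnds (proj₂ (suffixSums (map load z))) z)) (zipEnds-tabulate jobOf (encodeSide ∘ side)) ⟩
      map place-at (zipEnds (proj₂ (suffixSums (map load (tabulate entry)))) (tabulate entry))
        ≡⟨ cong (λ z → map place-at (zipEnds (proj₂ (suffixSums z)) (tabulate entry)))
             (trans (map-tabulate entry load) (tabulate-cong λ j → load≡ (side j) j)) ⟩
      map place-at (zipEnds (proj₂ (suffixSums (tabulate loads))) (tabulate entry))
        ≡⟨ cong (λ z → map place-at (zipEnds (proj₂ z) (tabulate entry))) (suffixSums-tabulate loads) ⟩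
      map place-at (zipEnds (tabulate (suffixAt loads)) (tabulate entry))
        ≡⟨ cong (map place-at) (zipEnds-tabulate (suffixAt loads) entry) ⟩
      map place-at (tabulate (λ j → suffixAt loads j , entry j))
        ≡⟨ map-tabulate (λ j → suffixAt loads j , entry j) place-at ⟩
      encodeSchedule build ∎
      where
      open ≡-Reasoning
      entry : Job → ⟦ job ⊗ place ⟧
      entry j = jobOf j , encodeSide (side j)
      place-at : ⟦ nat ⊗ job ⊗ place ⟧ → ⟦ place ⊗ nat ⟧
      place-at (s , j , l) = l , completionTime (toℕ source) (toℕ sink) M s (j , l)
      load≡ : ∀ s j → load (jobOf j , encodeSide s) ≡ onServer s j
      load≡ server j = refl
      load≡ cloud  j = refl

    completion-source : completion source ≡ 0
    completion-source = if≡-yes (toℕ source)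

    completion-sink : sink ≢ source → completion sink ≡ M
    completion-sink t≢s = trans (if≡-no (t≢s ∘ toℕ-injective)) (if≡-yes (toℕ sink))

    -- An inequality, because `completionTime` tests for the source first: if it is also the sink,
    -- the makespan is 0.
    makespan≤ : makespan build ≤ M
    makespan≤ with sink Finₚ.≟ source
    ... | yes t≡s = ≤-trans (≤-reflexive (trans (cong completion t≡s) completion-source)) z≤n
    ... | no  t≢s = ≤-reflexive (completion-sink t≢s)

    completion-inner : ∀ {j} → Inner j → completion j ≡
      case (encodeSide (side j)) (λ _ → suffixAt loads j) (λ _ → case (proj₂ (proj₂ (jobOf j))) (λ _ → 0) (λ (_ , a , _) → a))
    completion-inner (j≢s , j≢t) = trans (if≡-no (j≢s ∘ toℕ-injective)) (if≡-no (j≢t ∘ toℕ-injective))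

    completion-server : ∀ {j} → Inner j → side j ≡ server → completion j ≡ suffixAt loads j
    completion-server {j} inner eq = trans (completion-inner inner)
      (cong (λ s → case (encodeSide s) (λ _ → suffixAt loads j) (λ _ → case (proj₂ (proj₂ (jobOf j))) (λ _ → 0) (λ (_ , a , _) → a))) eq)

    completion-cloud : ∀ {j c x y} → side j ≡ cloud → cloudTime j ≡ just c → delay source j ≡ just x → delay j sink ≡ just y →
                       completion j ≡ x + c
    completion-cloud {j} eq c≡ x≡ y≡ with completion-inner (finite⇒inner c≡)
    ... | C≡ rewrite eq | c≡ | x≡ | y≡ = C≡

    module _ (affordable : Affordable M side) (load≤M : serverLoad side ≤ M) where

      endpoint-server : ∀ {j} → ¬ Inner j → side j ≡ server
      endpoint-server {j} endpoint with side j in eq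
      ... | server = refl
      ... | cloud  = contradiction (finite⇒inner (cloudTime≡ (affordable j eq))) endpoint

      build-source-server : side source ≡ server
      build-source-server = endpoint-server (λ (s≢s , _) → s≢s refl)

      build-sink-server : side sink ≡ server
      build-sink-server = endpoint-server (λ (_ , t≢t) → t≢t refl)

      loads-server : ∀ {j} → side j ≡ server → loads j ≡ serverTime j
      loads-server {j} eq = cong (λ s → onServer s j) eq

      build-cost : totalCost build ≡ just (cloudLoad side)
      build-cost = Σ∞-finite⁺ (cloudCost build) _ (cloudCost-onCloud build (λ j eq → _ , cloudTime≡ (affordable j eq)))

      server-start : ∀ {x j} → side j ≡ server → x + serverTime j ≤ completion j → _≤start_ build x j
      server-start eq = start⁺ build (procTime-server build eq)

      completion≤M : ∀ {j} → Inner j → side j ≡ server → completion j ≤ M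
      completion≤M {j} inner eq = ≤-trans (≤-reflexive (completion-server inner eq)) (≤-trans (suffixAt-≤ loads j) load≤M)

      source-first : ∀ {j} → side j ≡ server → _≤start_ build (completion source) j
      source-first {j} eq = server-start eq (≤-trans (≤-reflexive (cong (_+ serverTime j) completion-source)) enough)
        where
        enough : serverTime j ≤ completion j
        enough with j Finₚ.≟ source | j Finₚ.≟ sink
        ... | yes refl | _        = ≤-trans (≤-reflexive serverTime-source) z≤n
        ... | no _     | yes refl = ≤-trans (≤-reflexive serverTime-sink) z≤n
        ... | no j≢s   | no j≢t   = begin
          serverTime j      ≡⟨ loads-server eq ⟨
          loads j           ≤⟨ ≤-suffixAt loads j ⟩
          suffixAt loads j  ≡⟨ completion-server (j≢s , j≢t) eq ⟨
          completion j      ∎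
          where open ≤-Reasoning

      sink-last : ∀ {j} → Inner j → side j ≡ server → sink ≢ source → _≤start_ build (completion j) sink
      sink-last {j} inner eq t≢s = server-start build-sink-server (begin
        completion j + serverTime sink  ≡⟨ cong (completion j +_) serverTime-sink ⟩
        completion j + 0                ≡⟨ +-identityʳ _ ⟩
        completion j                    ≤⟨ completion≤M inner eq ⟩
        M                               ≡⟨ completion-sink t≢s ⟨
        completion sink                 ∎)
        where open ≤-Reasoning

      one-after-another : ∀ {i j} → Inner i → Inner j → side i ≡ server → side j ≡ server → i Fin.< j →
                          _≤start_ build (completion j) i
      one-after-another {i} {j} inner-i inner-j si sj i<j = server-start si (begin
        completion j + serverTime i    ≡⟨ cong₂ _+_ (completion-server inner-j sj) (sym (loads-server si)) ⟩
        suffixAt loads j + loads i     ≤⟨ suffixAt-< loads i<j ⟩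
        suffixAt loads i               ≡⟨ completion-server inner-i si ⟨
        completion i                   ∎)
        where open ≤-Reasoning

      build-valid : Valid build
      build-valid = record { machine = sequential ; precedence = ordered ; transfer = communicated }
        where
        sequential : ∀ i j → i ≢ j → side i ≡ server → side j ≡ server →
                     _≤start_ build (completion i) j ⊎ _≤start_ build (completion j) i
        sequential i j i≢j si sj with i Finₚ.≟ source | j Finₚ.≟ source | i Finₚ.≟ sink | j Finₚ.≟ sink
        ... | yes refl | _        | _        | _        = inj₁ (source-first sj)
        ... | _        | yes refl | _        | _        = inj₂ (source-first si)
        ... | _        | _        | yes refl | yes refl = contradiction refl i≢j
        ... | no i≢s   | no j≢s   | yes refl | no j≢t   = inj₂ (sink-last (j≢s , j≢t) sj i≢s)
        ... | no i≢s   | no j≢s   | no i≢t   | yes refl = inj₁ (sink-last (i≢s , i≢t) si j≢s)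
        -- Of two inner jobs the one with the larger index runs first.
        ... | no i≢s   | no j≢s   | no i≢t   | no j≢t   with Finₚ.<-cmp i j
        ...   | tri< i<j _ _ = inj₂ (one-after-another (i≢s , i≢t) (j≢s , j≢t) si sj i<j)
        ...   | tri≈ _ i≡j _ = contradiction i≡j i≢j
        ...   | tri> _ _ j<i = inj₁ (one-after-another (j≢s , j≢t) (i≢s , i≢t) sj si j<i)

        -- Every edge touches the source or the sink, so ends on the same side are both on the
        -- server.
        ordered : ∀ i j → Edge i j → side i ≡ side j → _≤start_ build (completion i) j
        ordered i j e same with edgeView i j e
        ... | fork inner     = source-first (trans (sym same) build-source-server)
        ... | join inner t≢s = sink-last inner (trans same build-sink-server) t≢s
        ... | bypass         = source-first build-sink-server

        is-cloud : ∀ {i j} → side i ≡ server → side i ≢ side j → side j ≡ cloud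
        is-cloud {i} {j} si different with side j
        ... | server = contradiction si different
        ... | cloud  = refl

        communicated : ∀ i j c → delay i j ≡ just c → side i ≢ side j → _≤start_ build (completion i + c) j
        communicated i j c c≡ different with edgeView i j (just-is c≡)
        ... | bypass = contradiction (trans build-source-server (sym build-sink-server)) different
        ... | fork inner with is-cloud build-source-server different
        ...   | j-cloud with affordable j j-cloud
        ...     | offloadable {x} {y} {w} w≡ x≡ y≡ _ with trans (sym x≡) c≡
        ...       | refl = start⁺ build (procTime-cloud build j-cloud w≡) (≤-reflexive (begin
          completion source + x + w  ≡⟨ cong (λ C → C + x + w) completion-source ⟩
          x + w                      ≡⟨ completion-cloud j-cloud w≡ x≡ y≡ ⟨
          completion j               ∎))
          where open ≡-Reasoning
        communicated i j c c≡ different | join inner t≢s with is-cloud build-sink-server (different ∘ sym)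
        ...   | i-cloud with affordable i i-cloud
        ...     | offloadable {x} {y} {w} w≡ x≡ y≡ back≤M with trans (sym y≡) c≡
        ...       | refl = server-start build-sink-server (begin
          completion i + y + serverTime sink  ≡⟨ cong₂ (λ C p → C + y + p) (completion-cloud i-cloud w≡ x≡ y≡) serverTime-sink ⟩
          x + w + y + 0                       ≡⟨ +-identityʳ _ ⟩
          x + w + y                           ≤⟨ back≤M ⟩
          M                                   ≡⟨ completion-sink t≢s ⟨
          completion sink                     ∎)
          where open ≤-Reasoning

  -- Assignments of sides as knapsack choices

  choice : Objective → Side → Job → ⟦ option ⟧
  choice obj s j = orient obj (onServer s j , onCloud s j) (encodeSide s)

  ∈-options⁺ : ∀ obj {L s j} → (s ≡ cloud → Offloadable L j) → choice obj s j ∈ options obj L (jobOf j)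
  ∈-options⁺ obj {s = server} _ = here refl
  ∈-options⁺ obj {s = cloud}  f with f refl
  ... | offloadable c≡ x≡ y≡ in-time rewrite c≡ | x≡ | y≡ = there (subst (_ ∈_) (sym (if≤-yes in-time)) (here refl))

  ∈-options⁻ : ∀ obj {L j o} → o ∈ options obj L (jobOf j) →
               ∃ λ s → o ≡ choice obj s j × (s ≡ cloud → Offloadable L j)
  ∈-options⁻ obj (here refl) = server , refl , λ ()
  ∈-options⁻ obj {L} {j} (there o∈) with cloudTime j in c≡ | delay source j in x≡ | delay j sink in y≡
  ... | just c | just x | just y with x + c + y ≤? L
  ...   | no  _ with () ← o∈
  ...   | yes in-time with here refl ← o∈ = cloud , cong (λ m → orient obj (0 , finite m) (inj₂ tt)) (sym c≡) , λ _ → offloadable c≡ x≡ y≡ in-time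

  weightLoad costLoad : Objective → (Job → Side) → ℕ
  weightLoad obj side = Σ[ (λ j → proj₁ (choice obj (side j) j)) ]
  costLoad   obj side = Σ[ (λ j → proj₁ (proj₂ (choice obj (side j) j))) ]

  module _ (side : Job → Side) where

    chosen : Objective → List ⟦ option ⟧
    chosen obj = tabulate (λ j → choice obj (side j) j)

    weightOf-chosen : ∀ obj → weightOf (chosen obj) ≡ weightLoad obj side
    weightOf-chosen obj = cong sum (map-tabulate (λ j → choice obj (side j) j) proj₁)

    costOf-chosen : ∀ obj → costOf (chosen obj) ≡ costLoad obj side
    costOf-chosen obj = cong sum (map-tabulate (λ j → choice obj (side j) j) (proj₁ ∘ proj₂))

    labelsOf-chosen : ∀ obj → labelsOf (chosen obj) ≡ tabulate (encodeSide ∘ side)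
    labelsOf-chosen min-cost     = map-tabulate (λ j → choice min-cost (side j) j) (proj₂ ∘ proj₂)
    labelsOf-chosen min-makespan = map-tabulate (λ j → choice min-makespan (side j) j) (proj₂ ∘ proj₂)

  module _ (ks : List ⊤) (bound : ℕ) where

    items : Objective → ℕ → List (List ⟦ option ⟧)
    items obj L = map (options obj L) (tabulate jobOf)

    items-tabulate : ∀ obj L → items obj L ≡ tabulate (options obj L ∘ jobOf)
    items-tabulate obj L = map-tabulate jobOf (options obj L)

    assignment-sound : ∀ obj {L c ls} → (c , ls) ∈ solutions ks (items obj L) bound →
      ∃ λ side → Affordable L side × ls ≡ tabulate (encodeSide ∘ side) × weightLoad obj side ≤ bound × c ≡ costLoad obj side
    assignment-sound obj {L} s∈ with solutions-sound ks (items obj L) s∈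
    ... | os , os∈ , weight≤ , c≡ , ls≡
      with chosen-tabulate (options obj L ∘ jobOf) (subst (Chosen os) (items-tabulate obj L) os∈)
    ...   | o , refl , o∈ =
      side , (λ j → proj₂ (proj₂ (∈-options⁻ obj (o∈ j)))) ,
      trans ls≡ (trans (cong labelsOf os≡) (labelsOf-chosen side obj)) ,
      ≤-trans (≤-reflexive (sym (trans (cong weightOf os≡) (weightOf-chosen side obj)))) weight≤ ,
      trans c≡ (trans (cong costOf os≡) (costOf-chosen side obj))
      where
      side : Job → Side
      side j = proj₁ (∈-options⁻ obj (o∈ j))
      os≡ : tabulate o ≡ chosen side obj
      os≡ = tabulate-cong (λ j → proj₁ (proj₂ (∈-options⁻ obj (o∈ j))))

    -- The inequality v ≤ w + max(1, w) / (k + 1), cleared of its denominator, with k the number of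
    -- units in `ks`.
    NearlyOptimal : ℕ → ℕ → Set
    NearlyOptimal v w = suc (length ks) * v ≤ suc (length ks) * w + (1 ⊔ w)

    assignment-complete : ∀ obj {L side} → Affordable L side → weightLoad obj side ≤ bound →
      ∃₂ λ c ls → (c , ls) ∈ solutions ks (items obj L) bound × NearlyOptimal c (costLoad obj side)
    assignment-complete obj {L} {side} affordable weight≤
      with solutions-complete ks (items obj L) {bound} {chosen side obj}
             (subst (Chosen (chosen side obj)) (sym (items-tabulate obj L)) (tabulate⁺ (λ j → ∈-options⁺ obj (affordable j))))
             (≤-trans (≤-reflexive (weightOf-chosen side obj)) weight≤)
    ... | c , ls , s∈ , c≤ = c , ls , s∈ , subst (NearlyOptimal c) (costOf-chosen side obj) c≤

    relax : ∀ {L M side} → L ≤ M → Affordable L side → Affordable M side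
    relax L≤M affordable j j-cloud with affordable j j-cloud
    ... | offloadable c≡ x≡ y≡ in-time = offloadable c≡ x≡ y≡ (≤-trans in-time L≤M)

    Meets : Objective → (Job → Side) → ℕ → ℕ → Set
    Meets min-cost     side M v = M ≡ bound × v ≡ cloudLoad side
    Meets min-makespan side M v = cloudLoad side ≤ bound × v ≡ M

    data Sound (obj : Objective) : ℕ × ℕ × List ⟦ place ⟧ → Set where
      sound : ∀ {v M ls} side → Affordable M side → serverLoad side ≤ M → ls ≡ tabulate (encodeSide ∘ side) →
              Meets obj side M v → Sound obj (v , M , ls)

    candidates-sound : ∀ obj {x} → x ∈ candidates obj ks (tabulate jobOf) bound → Sound obj x
    candidates-sound obj x∈ with find (∈-concatMap⁻ (candidatesAt obj ks (tabulate jobOf) bound) {xs = thresholds obj bound (tabulate jobOf)} x∈)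
    ... | L , L∈ , x∈L with ∈-map⁻ (evaluate obj L) x∈L
    ...   | (c , ls) , s∈ , refl with assignment-sound obj s∈
    candidates-sound min-cost     x∈ | L , here refl , _ | (c , ls) , s∈ , refl | side , affordable , ls≡ , weight≤ , c≡ =
      sound side affordable weight≤ ls≡ (refl , c≡)
    candidates-sound min-makespan x∈ | L , _ , _ | (c , ls) , s∈ , refl | side , affordable , ls≡ , weight≤ , c≡ =
      sound side (relax (m≤n+m∸n L c) affordable) (≤-trans (≤-reflexive (sym c≡)) (m≤m+n c (L ∸ c))) ls≡ (weight≤ , refl)

    candidates-complete-cost : ∀ {side} → Affordable bound side → serverLoad side ≤ bound →
      ∃₂ λ v r → (v , r) ∈ candidates min-cost ks (tabulate jobOf) bound × NearlyOptimal v (cloudLoad side)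
    candidates-complete-cost affordable load≤ with assignment-complete min-cost affordable load≤
    ... | c , ls , s∈ , c≤ = c , (bound , ls) , ∈-concatMap⁺ (candidatesAt min-cost ks (tabulate jobOf) bound) {xs = bound ∷ []} (here (∈-map⁺ (evaluate min-cost bound) s∈)) , c≤

    ∈-thresholds : ∀ {L j} → (o : Offloadable L j) → (out-delay o + work o) + back-delay o ∈ thresholds min-makespan bound (tabulate jobOf)
    ∈-thresholds {L} {j} (offloadable {x} {y} {c} c≡ x≡ y≡ _) = there (∈-concatMap⁺ backTime (lose (∈-tabulate⁺ j) back∈))
      where
      back∈ : x + c + y ∈ backTime (jobOf j)
      back∈ rewrite c≡ | x≡ | y≡ = here refl

    -- If the threshold attains the maximum there is no error at all, as `L ≤ w`; otherwise the
    -- maximum is the approximated load, whose bound is monotone in `load`.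
    NearlyOptimal-⊔ : ∀ {v L w load} → L ≤ w → load ≤ w → NearlyOptimal v load → NearlyOptimal (v + (L ∸ v)) w
    NearlyOptimal-⊔ {v} {L} {w} {load} L≤w load≤w v≤ with v ≤? L
    ... | yes v≤L = ≤-trans (≤-trans (≤-reflexive (cong (K *_) (m+[n∸m]≡n v≤L))) (*-monoʳ-≤ K L≤w)) (m≤m+n _ _)
      where
      K : ℕ
      K = suc (length ks)
    ... | no  v≰L = begin
      K * (v + (L ∸ v))      ≡⟨ cong (λ r → K * (v + r)) (m≤n⇒m∸n≡0 (<⇒≤ (≰⇒> v≰L))) ⟩
      K * (v + 0)            ≡⟨ cong (K *_) (+-identityʳ v) ⟩
      K * v                  ≤⟨ v≤ ⟩
      K * load + (1 ⊔ load)  ≤⟨ +-mono-≤ (*-monoʳ-≤ K load≤w) (⊔-monoʳ-≤ 1 load≤w) ⟩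
      K * w + (1 ⊔ w)        ∎
      where
      open ≤-Reasoning
      K : ℕ
      K = suc (length ks)

    -- Lower the threshold from `w` to the largest candidate `L ≤ w`. Each offloaded job returns by
    -- `w` and its return time is a candidate, so it also returns by `L`; the value 0 is the
    -- candidate left if nothing is offloaded in time.
    candidates-complete-makespan : ∀ {side w} → Affordable w side → serverLoad side ≤ w → cloudLoad side ≤ bound →
      ∃₂ λ v r → (v , r) ∈ candidates min-makespan ks (tabulate jobOf) bound × NearlyOptimal v w
    candidates-complete-makespan {side} {w} affordable load≤w cost≤ = try (largest-below backTimes {0} {w} z≤n)
      where
      backTimes : List ℕ
      backTimes = concatMap backTime (tabulate jobOf)

      Goal : Set
      Goal = ∃₂ λ v r → (v , r) ∈ candidates min-makespan ks (tabulate jobOf) bound × NearlyOptimal v w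

      extend-to : ∀ {L} → L ∈ thresholds min-makespan bound (tabulate jobOf) → L ≤ w →
        (∃₂ λ c ls → (c , ls) ∈ solutions ks (items min-makespan L) bound × NearlyOptimal c (serverLoad side)) → Goal
      extend-to {L} L∈ L≤w (c , ls , s∈ , c≤) = c + (L ∸ c) , (c + (L ∸ c) , ls) ,
        ∈-concatMap⁺ (candidatesAt min-makespan ks (tabulate jobOf) bound)
          (lose L∈ (∈-map⁺ (evaluate min-makespan L) s∈)) ,
        NearlyOptimal-⊔ {c} {L} {w} {serverLoad side} L≤w load≤w c≤

      try : (∃ λ L → L ∈ 0 ∷ backTimes × L ≤ w × (∀ {x} → x ∈ 0 ∷ backTimes → x ≤ w → x ≤ L)) → Goal
      try (L , L∈ , L≤w , below) = extend-to L∈ L≤w (assignment-complete min-makespan tight cost≤)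
        where
        tight : Affordable L side
        tight j j-cloud with affordable j j-cloud
        ... | o@(offloadable c≡ x≡ y≡ in-time) = offloadable c≡ x≡ y≡ (below (∈-thresholds o) in-time)

-- Rational accuracies

fromℕ≡mkℚ : ∀ n → fromℕ n ≡ mkℚ (ℤ.+ n) 0 (Coprimality.sym (1-coprimeTo n))
fromℕ≡mkℚ n = ℚ.normalize-coprime (Coprimality.sym (1-coprimeTo n))

fromℕ-mono : ∀ {m n} → m ≤ n → fromℕ m ℚ.≤ fromℕ n
fromℕ-mono {m} {n} m≤n rewrite fromℕ≡mkℚ m | fromℕ≡mkℚ n =
  ℚ.*≤* (ℤ.*-monoʳ-≤-nonNeg (ℤ.+ 1) (ℤ.+≤+ m≤n))

fromℕ-+ : ∀ m n → fromℕ m ℚ.+ fromℕ n ≡ fromℕ (m + n)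
fromℕ-+ m n = trans (cong₂ ℚ._+_ (fromℕ≡mkℚ m) (fromℕ≡mkℚ n))
  (cong (ℚ._/ 1) (cong₂ ℤ._+_ (ℤ.*-identityʳ (ℤ.+ m)) (ℤ.*-identityʳ (ℤ.+ n))))

fromℕ-* : ∀ m n → fromℕ m ℚ.* fromℕ n ≡ fromℕ (m * n)
fromℕ-* m n = trans (cong₂ ℚ._*_ (fromℕ≡mkℚ m) (fromℕ≡mkℚ n))
  (cong (ℚ._/ 1) (sym (ℤ.pos-* m n)))

fromℕ-positive : ∀ n → ℚ.Positive (fromℕ (suc n))
fromℕ-positive n = subst ℚ.Positive (sym (fromℕ≡mkℚ (suc n))) _

fromℕ-nonNegative : ∀ n → ℚ.NonNegative (fromℕ n)
fromℕ-nonNegative n = subst ℚ.NonNegative (sym (fromℕ≡mkℚ n)) _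

floor-≤ : ∀ p → ℚ.floor p ℤ.* ℚ.↧ p ℤ.≤ ℚ.↥ p
floor-≤ p@record{} = ℤ.[n/d]*d≤n (ℚ.↥ p) (ℚ.↧ p)

-- The ceiling is the negated floor of the negation, and passing to the absolute value can only
-- increase it.
≤⌈⌉ : ∀ q → q ℚ.≤ fromℕ ℤ.∣ ℚ.ceiling q ∣
≤⌈⌉ q@record{} = subst (q ℚ.≤_) (sym (fromℕ≡mkℚ ℤ.∣ ℚ.ceiling q ∣)) (ℚ.*≤* (begin
  ℚ.↥ q ℤ.* ℤ.+ 1                             ≡⟨ ℤ.*-identityʳ (ℚ.↥ q) ⟩
  ℚ.↥ q                                       ≡⟨ ℤ.neg-involutive (ℚ.↥ q) ⟨
  ℤ.- (ℤ.- ℚ.↥ q)                             ≡⟨ cong ℤ.-_ (ℚ.↥-neg q) ⟨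
  ℤ.- ℚ.↥ (ℚ.- q)                             ≤⟨ ℤ.neg-mono-≤ (floor-≤ (ℚ.- q)) ⟩
  ℤ.- (ℚ.floor (ℚ.- q) ℤ.* ℚ.↧ (ℚ.- q))       ≡⟨ ℤ.neg-distribˡ-* (ℚ.floor (ℚ.- q)) (ℚ.↧ (ℚ.- q)) ⟩
  ℚ.ceiling q ℤ.* ℚ.↧ (ℚ.- q)                 ≡⟨ cong (ℚ.ceiling q ℤ.*_) (ℚ.↧-neg q) ⟩
  ℚ.ceiling q ℤ.* ℚ.↧ q                       ≤⟨ ℤ.*-monoʳ-≤-nonNeg (ℚ.↧ q) (i≤∣i∣ (ℚ.ceiling q)) ⟩
  ℤ.+ ℤ.∣ ℚ.ceiling q ∣ ℤ.* ℚ.↧ q             ∎))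
  where
  open ℤ.≤-Reasoning
  i≤∣i∣ : ∀ i → i ℤ.≤ ℤ.+ ℤ.∣ i ∣
  i≤∣i∣ (ℤ.+ n)      = ℤ.≤-refl
  i≤∣i∣ (ℤ.-[1+ n ]) = ℤ.-≤+

module _ (ε : ℚ) .{{ε>0 : ℚ.Positive ε}} where

  private instance
    _ = ℚ.pos⇒nonZero ε
    _ = ℚ.pos⇒nonNeg ε

  1≤ε*⌈1/ε⌉ : 1ℚ ℚ.≤ ε ℚ.* fromℕ ⌈1/ ε ⌉
  1≤ε*⌈1/ε⌉ = begin
    1ℚ                     ≡⟨ ℚ.*-inverseʳ ε ⟨
    ε ℚ.* (1/ ε)           ≤⟨ ℚ.*-monoˡ-≤-nonNeg ε (≤⌈⌉ (1/ ε)) ⟩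
    ε ℚ.* fromℕ ⌈1/ ε ⌉    ∎
    where open ℚ.≤-Reasoning

  1≤⌈1/ε⌉ : 1 ≤ ⌈1/ ε ⌉
  1≤⌈1/ε⌉ with ⌈1/ ε ⌉ | 1≤ε*⌈1/ε⌉
  ... | suc _ | _   = s≤s z≤n
  ... | zero  | 1≤0 with ℚ.*≤* (ℤ.+≤+ ()) ← subst (1ℚ ℚ.≤_) (ℚ.*-zeroʳ ε) 1≤0

  private
    -- One more than `⌈1/ ε ⌉`, so that K ≥ 2 even when ε is at least 1.
    K : ℕ
    K = suc ⌈1/ ε ⌉

  one-more : ∀ w → fromℕ (K * w + w) ℚ.≤ fromℕ K ℚ.* ((1ℚ ℚ.+ ε) ℚ.* fromℕ w)
  one-more w = begin
    fromℕ (K * w + w)                                  ≡⟨ fromℕ-+ (K * w) w ⟨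
    fromℕ (K * w) ℚ.+ fromℕ w                          ≡⟨ cong₂ ℚ._+_ (fromℕ-* K w) (ℚ.*-identityˡ (fromℕ w)) ⟨
    fromℕ K ℚ.* fromℕ w ℚ.+ 1ℚ ℚ.* fromℕ w             ≤⟨ ℚ.+-monoʳ-≤ (fromℕ K ℚ.* fromℕ w)
                                                            (ℚ.*-monoʳ-≤-nonNeg (fromℕ w) {{fromℕ-nonNegative w}} 1≤K*ε) ⟩
    fromℕ K ℚ.* fromℕ w ℚ.+ (fromℕ K ℚ.* ε) ℚ.* fromℕ w ≡⟨ cong (fromℕ K ℚ.* fromℕ w ℚ.+_) (ℚ.*-assoc (fromℕ K) ε (fromℕ w)) ⟩
    fromℕ K ℚ.* fromℕ w ℚ.+ fromℕ K ℚ.* (ε ℚ.* fromℕ w) ≡⟨ ℚ.*-distribˡ-+ (fromℕ K) (fromℕ w) (ε ℚ.* fromℕ w) ⟨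
    fromℕ K ℚ.* (fromℕ w ℚ.+ ε ℚ.* fromℕ w)            ≡⟨ cong (λ x → fromℕ K ℚ.* (x ℚ.+ ε ℚ.* fromℕ w)) (ℚ.*-identityˡ (fromℕ w)) ⟨
    fromℕ K ℚ.* (1ℚ ℚ.* fromℕ w ℚ.+ ε ℚ.* fromℕ w)     ≡⟨ cong (fromℕ K ℚ.*_) (ℚ.*-distribʳ-+ (fromℕ w) 1ℚ ε) ⟨
    fromℕ K ℚ.* ((1ℚ ℚ.+ ε) ℚ.* fromℕ w)               ∎
    where
    open ℚ.≤-Reasoning
    1≤K*ε : 1ℚ ℚ.≤ fromℕ K ℚ.* ε
    1≤K*ε = begin
      1ℚ                     ≤⟨ 1≤ε*⌈1/ε⌉ ⟩
      ε ℚ.* fromℕ ⌈1/ ε ⌉    ≤⟨ ℚ.*-monoˡ-≤-nonNeg ε (fromℕ-mono (n≤1+n ⌈1/ ε ⌉)) ⟩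
      ε ℚ.* fromℕ K          ≡⟨ ℚ.*-comm ε (fromℕ K) ⟩
      fromℕ K ℚ.* ε          ∎

  nearlyOptimal⇒≤ : ∀ v w → K * v ≤ K * w + (1 ⊔ w) → fromℕ v ℚ.≤ (1ℚ ℚ.+ ε) ℚ.* fromℕ w
  nearlyOptimal⇒≤ v w v≤ = ℚ.*-cancelˡ-≤-pos (fromℕ K) {{fromℕ-positive ⌈1/ ε ⌉}} (begin
    fromℕ K ℚ.* fromℕ v                     ≡⟨ fromℕ-* K v ⟩
    fromℕ (K * v)                           ≤⟨ fromℕ-mono (absorb v w v≤) ⟩
    fromℕ (K * w + w)                       ≤⟨ one-more w ⟩
    fromℕ K ℚ.* ((1ℚ ℚ.+ ε) ℚ.* fromℕ w)    ∎)
    where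
    open ℚ.≤-Reasoning
    -- K ≥ 2 leaves only v = 0 when w = 0.
    absorb : ∀ v w → K * v ≤ K * w + (1 ⊔ w) → K * v ≤ K * w + w
    absorb v       (suc w) v≤ = v≤
    absorb zero    zero    v≤ = ≤-reflexive (sym (+-identityʳ _))
    absorb (suc v) zero    v≤ = contradiction
      (≤-trans (m≤m*n K (suc v)) (≤-trans v≤ (≤-reflexive (cong (_+ 1) (*-zeroʳ K)))))
      (<⇒≱ (s≤s 1≤⌈1/ε⌉))

-- The accuracy in unary

-- Written with an accumulator so that it is the iteration performed by the loop of `countdown`.
unary : ℕ → List ⊤ → List ⊤
unary zero    us = us
unary (suc n) us = unary n (tt ∷ us)

length-unary : ∀ n us → length (unary n us) ≡ n + length us
length-unary zero    us = refl
length-unary (suc n) us = trans (length-unary n (tt ∷ us)) (+-suc n (length us))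

size-units : ∀ (us : List ⊤) → size (list unit) us ≡ 1 + 2 * length us
size-units []       = refl
size-units (_ ∷ us) = cong suc (trans (cong suc (size-units us)) (sym (*-suc 2 (length us))))

countdown : nat ⊗ list unit ⇒ (nat ⊗ list unit) ⊕ list unit
countdown = ifLeq (basic fst & basic (lit 0)) (basic snd then basic inr)
  ((binary sub (basic fst) (basic (lit 1)) & (basic drop :: basic snd)) then basic inl)

unaryTime : ℕ → List ⊤ → ℕ
unaryTime zero    us = suc (time countdown (0 , us))
unaryTime (suc n) us = suc (time countdown (suc n , us) + unaryTime n (tt ∷ us))

unary-run : ∀ n us → loop (code countdown) ∙ (n , us) ⇓ unary n us cost unaryTime n us
unary-run zero    us = stop (run countdown (0 , us))
unary-run (suc n) us = continue (run countdown (suc n , us)) (unary-run n (tt ∷ us))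

-- The number of rounds is exponential in the binary size of `k`, so this loop is no `⇒` and is
-- bounded by hand in terms of `k`. The invariant limits each state to size 3 + 2k: a number is at
-- most its successor in size, and each unit costs 2.
unaryTime-bound : ∀ {k} n us → n + length us ≡ k →
                  unaryTime n us ≤ suc n * suc ((2 + (3 + 2 * k)) ^ proj₁ (time≲ countdown))
unaryTime-bound {k} n us eq = go n us eq
  where
  e : ℕ
  e = proj₁ (time≲ countdown)
  step : ∀ n us → n + length us ≡ k → time countdown (n , us) ≤ (2 + (3 + 2 * k)) ^ e
  step n us eq = ≤-trans (proj₂ (time≲ countdown) (n , us)) (^-monoˡ-≤ e (+-monoʳ-≤ 2 (begin
    suc (size nat n + size (list unit) us)   ≤⟨ s≤s (+-mono-≤ (size≤1+n n) (≤-reflexive (size-units us))) ⟩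
    suc (suc n + (1 + 2 * length us))        ≡⟨ cong (2 +_) (+-suc n (2 * length us)) ⟩
    3 + (n + 2 * length us)                  ≤⟨ +-monoʳ-≤ 3 (+-monoˡ-≤ _ (m≤m+n n (n + 0))) ⟩
    3 + (2 * n + 2 * length us)              ≡⟨ cong (3 +_) (*-distribˡ-+ 2 n (length us)) ⟨
    3 + 2 * (n + length us)                  ≡⟨ cong (λ k → 3 + 2 * k) eq ⟩
    3 + 2 * k                                ∎)))
    where open ≤-Reasoning
  go : ∀ n us → n + length us ≡ k → unaryTime n us ≤ suc n * suc ((2 + (3 + 2 * k)) ^ e)
  go zero    us eq = s≤s (≤-trans (step 0 us eq) (m≤m+n _ _))
  go (suc n) us eq = s≤s (+-mono-≤ (step (suc n) us eq) (go n (tt ∷ us) (trans (+-suc n (length us)) eq)))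

module _ {A B : Ty} (f : list unit ⊗ A ⇒ B) where

  withUnary : Program (nat ⊗ A) B
  withUnary = pair (pair (op fst) (op nil) ⨾ loop (code countdown)) (op snd) ⨾ code f

  private
    X : Set
    X = ℕ × ⟦ A ⟧

    measure : X → ℕ
    measure (k , x) = size A x + k

    k≲ : proj₁ ≲ measure
    k≲ = ≲-mono (λ (k , x) → m≤n+m k (size A x)) ≲-measure

    size-k≲ : (λ ((k , _) : X) → size nat k) ≲ measure
    size-k≲ = ≲-mono (λ (k , x) → size≤1+n k) (≲-suc k≲)

    size-x≲ : (λ ((_ , x) : X) → size A x) ≲ measure
    size-x≲ = ≲-mono (λ (k , x) → m≤m+n (size A x) k) ≲-measure

    size-unary≲ : (λ ((k , _) : X) → size (list unit) (unary k [])) ≲ measure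
    size-unary≲ = ≲-mono (λ (k , x) → ≤-reflexive (trans (size-units (unary k [])) (cong (λ n → 1 + 2 * n) (trans (length-unary k []) (+-identityʳ k)))))
      (≲-suc (≲-* (≲-const 2) k≲))

    input≲ : (λ ((k , x) : X) → size (nat ⊗ A) (k , x)) ≲ measure
    input≲ = ≲-suc (≲-+ size-k≲ size-x≲)

  withUnary-run : ∃ λ (t : X → ℕ) → (∀ k x → withUnary ∙ (k , x) ⇓ fun f (unary k [] , x) cost t (k , x)) × t ≲ measure
  withUnary-run = _ ,
    (λ k x → pair (pair (op fst (k , x)) (op nil (k , x)) ⨾ unary-run k []) (op snd (k , x)) ⨾ run f (unary k [] , x)) ,
    ≲-suc (≲-+
      (≲-suc (≲-+
        (≲-suc (≲-+
          (≲-suc (≲-+ (≲-+ input≲ size-k≲) (≲-+ input≲ (≲-const 1))))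
          (≲-mono (λ (k , x) → unaryTime-bound k [] (+-identityʳ k))
            (≲-* (≲-suc k≲) (≲-suc (≲-power (proj₁ (time≲ countdown)) (≲-+ (≲-const 3) (≲-* (≲-const 2) k≲))))))))
        (≲-+ input≲ size-x≲)))
      (≲-fun (time f) (λ (k , x) → unary k [] , x) (time≲ f) (≲-suc (≲-+ size-unary≲ size-x≲))))

-- From unary accuracy to an FPTAS

module _ (P : MinProblem) where
  open MinProblem P

  fptas : (f : list unit ⊗ input ⇒ unit ⊕ output) →
          (∀ I (ε : ℚ) .{{_ : ℚ.Positive ε}} us → length us ≡ ⌈1/ ε ⌉ → Approximates P I ε (fun f (us , encode I))) →
          FPTAS P
  fptas f approximates = record
    { program     = withUnary f
    -- Every value has size at least 1, so the measure m satisfies 2 + m ≤ 3m.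
    ; coefficient = 3 ^ e
    ; degree      = e
    ; correct     = λ I ε → let k = ⌈1/ ε ⌉ in
        _ , _ , proj₁ (proj₂ (withUnary-run f)) k (encode I) ,
        ≤-trans (proj₂ (proj₂ (proj₂ (withUnary-run f))) (k , encode I)) (bound (size input (encode I) + k) (≤-trans (size≥1 input (encode I)) (m≤m+n _ k))) ,
        approximates I ε (unary k []) (trans (length-unary k []) (+-identityʳ k))
    }
    where
    e : ℕ
    e = proj₁ (proj₂ (proj₂ (withUnary-run f)))

    size≥1 : ∀ A x → 1 ≤ size A x
    size≥1 nat      n        = s≤s z≤n
    size≥1 unit     _        = s≤s z≤n
    size≥1 (A ⊗ B)  _        = s≤s z≤n
    size≥1 (A ⊕ B)  (inj₁ _) = s≤s z≤n
    size≥1 (A ⊕ B)  (inj₂ _) = s≤s z≤n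
    size≥1 (list A) xs       = size-list-≥1 xs

    ^-distribʳ-* : ∀ a b n → (a * b) ^ n ≡ a ^ n * b ^ n
    ^-distribʳ-* a b zero    = refl
    ^-distribʳ-* a b (suc n) = trans (cong (a * b *_) (^-distribʳ-* a b n)) (interchange a b (a ^ n) (b ^ n))
      where open import Algebra.Properties.CommutativeSemigroup *-commutativeSemigroup using (interchange)

    bound : ∀ m → 1 ≤ m → (2 + m) ^ e ≤ 3 ^ e * m ^ e
    bound m 1≤m = begin
      (2 + m) ^ e        ≤⟨ ^-monoˡ-≤ e (≤-trans (+-monoˡ-≤ m (*-monoʳ-≤ 2 1≤m)) (≤-reflexive (+-comm (2 * m) m))) ⟩
      (3 * m) ^ e        ≡⟨ ^-distribʳ-* 3 m e ⟩
      3 ^ e * m ^ e      ∎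
      where open ≤-Reasoning

-- Approximation guarantees for the two objectives

module _ (G : TaskGraph) (parallel : FullyParallel G) (bound : ℕ) (ks : List ⊤) where
  open TaskGraph G
  open FullyParallelGraph G parallel

  -- `algorithm` with the job list as a parameter, so that the list read from the encoding can be
  -- replaced by `tabulate jobOf` by matching on an equation.
  solve : Objective → List ⟦ job ⟧ → ⟦ unit ⊕ schedule ⟧
  solve obj js = case (minBy (candidates obj ks js bound)) (λ _ → inj₁ tt)
    (λ (_ , M , ls) → inj₂ (assemble (toℕ source) (toℕ sink) M js ls))

  module _ (ε : ℚ) .{{_ : ℚ.Positive ε}} (ks≡ : length ks ≡ ⌈1/ ε ⌉) where

    close : ∀ {v v′} w → v ≤ v′ → NearlyOptimal ks bound v′ w → fromℕ v ℚ.≤ (1ℚ ℚ.+ ε) ℚ.* fromℕ w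
    close {v} {v′} w v≤ v′≤ = nearlyOptimal⇒≤ ε v w
      (≤-trans (*-monoʳ-≤ (suc ⌈1/ ε ⌉) v≤) (subst (λ k → suc k * v′ ≤ suc k * w + (1 ⊔ w)) ks≡ v′≤))

    approximates-cost : ∀ js → js ≡ tabulate jobOf →
                        Approximates MinCost ((G , parallel) , bound) ε (solve min-cost js)
    approximates-cost js refl = finish (minBy-minimum cands)
      where
      cands : List (ℕ × ℕ × List ⟦ place ⟧)
      cands = candidates min-cost ks (tabulate jobOf) bound

      competitor : ∀ σ w → Valid σ × makespan σ ≤ bound × totalCost σ ≡ just w →
                   ∃₂ λ v r → (v , r) ∈ cands × NearlyOptimal ks bound v w
      competitor σ w (valid , C≤ , cost≡)
        with candidates-complete-cost ks bound (relax ks bound C≤ (offloaded-in-time σ cost≡ valid))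
               (≤-trans (serverLoad≤makespan σ cost≡ valid) C≤)
      ... | v , r , v∈ , v≤ = v , r , v∈ , subst (NearlyOptimal ks bound v) (sym (cost≡cloudLoad σ cost≡)) v≤

      finish : ∀ {m} → Minimum cands m → Approximates MinCost ((G , parallel) , bound) ε
        (case m (λ _ → inj₁ tt) (λ (_ , M , ls) → inj₂ (assemble (toℕ source) (toℕ sink) M (tabulate jobOf) ls)))
      finish (none empty) = infeasible λ σ w feasible → absurd w (competitor σ w feasible)
        where
        absurd : ∀ w → ¬ (∃₂ λ v r → (v , r) ∈ cands × NearlyOptimal ks bound v w)
        absurd w (v , r , v∈ , _) with () ← subst ((v , r) ∈_) empty v∈
      finish (some v∈ v≤) with candidates-sound ks bound min-cost v∈
      ... | sound side affordable load≤ refl (refl , refl) =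
        subst (λ s → Approximates MinCost ((G , parallel) , bound) ε (inj₂ s)) (sym (assemble-build side bound))
          (solution (build side bound) (cloudLoad side)
            (build-valid side bound affordable load≤ , makespan≤ side bound , build-cost side bound affordable load≤)
            (λ σ w feasible → let (v , r , v∈′ , near) = competitor σ w feasible in close w (v≤ v∈′) near))

    approximates-makespan : ∀ js → js ≡ tabulate jobOf →
                            Approximates MinMakespan ((G , parallel) , bound) ε (solve min-makespan js)
    approximates-makespan js refl = finish (minBy-minimum cands)
      where
      cands : List (ℕ × ℕ × List ⟦ place ⟧)
      cands = candidates min-makespan ks (tabulate jobOf) bound

      competitor : ∀ σ w → Valid σ × totalCost σ ≤∞ just bound × makespan σ ≡ w →
                   ∃₂ λ v r → (v , r) ∈ cands × NearlyOptimal ks bound v w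
      competitor σ w (valid , cost≤ , refl) with finite-total cost≤
        where
        finite-total : ∀ {c} → c ≤∞ just bound → ∃ λ v → c ≡ just v × v ≤ bound
        finite-total [ v≤ ] = _ , refl , v≤
      ... | v , cost≡ , v≤ = candidates-complete-makespan ks bound (offloaded-in-time σ cost≡ valid)
        (serverLoad≤makespan σ cost≡ valid) (≤-trans (≤-reflexive (sym (cost≡cloudLoad σ cost≡))) v≤)

      finish : ∀ {m} → Minimum cands m → Approximates MinMakespan ((G , parallel) , bound) ε
        (case m (λ _ → inj₁ tt) (λ (_ , M , ls) → inj₂ (assemble (toℕ source) (toℕ sink) M (tabulate jobOf) ls)))
      finish (none empty) = infeasible λ σ w feasible → absurd w (competitor σ w feasible)
        where
        absurd : ∀ w → ¬ (∃₂ λ v r → (v , r) ∈ cands × NearlyOptimal ks bound v w)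
        absurd w (v , r , v∈ , _) with () ← subst ((v , r) ∈_) empty v∈
      finish (some {M , _} v∈ v≤) with candidates-sound ks bound min-makespan v∈
      ... | sound side affordable load≤ refl (cost≤ , refl) =
        subst (λ s → Approximates MinMakespan ((G , parallel) , bound) ε (inj₂ s)) (sym (assemble-build side M))
          -- The value claimed is the actual makespan, which may lie below the value `M` of the
          -- candidate; `makespan≤` bridges the gap.
          (solution (build side M) (makespan (build side M))
            (build-valid side M affordable load≤ ,
             subst (_≤∞ just bound) (sym (build-cost side M affordable load≤)) [ cost≤ ] , refl)
            (λ σ w feasible → let (v , r , v∈′ , near) = competitor σ w feasible in
              close w (≤-trans (makespan≤ side M) (v≤ v∈′)) near))

theorem3 : FPTAS MinCost × FPTAS MinMakespan
theorem3 =
  fptas MinCost (algorithmF min-cost)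
    (λ ((G , parallel) , bound) ε us us≡ →
       approximates-cost G parallel bound us ε us≡ _ (FullyParallelGraph.jobList-encodeGraph G parallel)) ,
  fptas MinMakespan (algorithmF min-makespan)
    (λ ((G , parallel) , bound) ε us us≡ →
       approximates-makespan G parallel bound us ε us≡ _ (FullyParallelGraph.jobList-encodeGraph G parallel))
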